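{- For every integer $k$ there exists an integer $n$ such that every plane triangulation on at least $n$ vertices has an $s$-nest of size at least $k$ for some $s\in\{0,1,2\}$.
   Context: Graphs are finite and may have loops and parallel edges. A plane triangulation is a graph embedded in the plane without crossings in which every face is bounded by a triangle. For a plane graph $G$, a nest is a sequence $C_1,\dots,C_t$ of pairwise edge-disjoint cycles of $G$ such that for each $i=1,\dots,t-1$ the cycle $C_{i+1}$ is contained in the closed disk bounded by $C_i$; $t$ is its size. If moreover there is a set $X\subseteq V(G)$ with $|X|=s$ such that $V(C_i)\cap V(C_j)=X$ for all distinct $i,j$, the nest is an $s$-nest. -}

module Defs where

open import Data.Nat using (ℕ; zero; suc; _+_; _*_; _≤_)
open import Data.Fin using (Fin; zero; suc; toℕ; inject₁; fromℕ)
open import Data.Fin.Subset using (Subset; ∣_∣) renaming (_∈_ to _∈ₛ_)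
open import Data.Product using (Σ; ∃; _×_; _,_)
open import Data.Sum using (_⊎_)
open import Relation.Nullary using (¬_)
open import Relation.Binary.PropositionalEquality using (_≡_; _≢_)
open import Function.Definitions using (Injective)
open import Function.Bundles using (_⇔_)

iter : {A : Set} → ℕ → (A → A) → A → A
iter zero    f x = x
iter (suc k) f x = f (iter k f x)

data Conn {d : ℕ} (α σ : Fin d → Fin d) (x : Fin d) : Fin d → Set where
  here  : Conn α σ x x
  stepα : ∀ {y} → Conn α σ x y → Conn α σ x (α y)
  stepσ : ∀ {y} → Conn α σ x y → Conn α σ x (σ y)

-- A plane triangulation with n vertices, given as a combinatorial map
-- (rotation system) on d darts (d = twice the number of edges).
--   α : edge involution (fixed point free), σ : rotation around vertices,
--   faces are the orbits of φ = σ ∘ α,  tail x = the vertex at which dart x starts.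
-- Vertices Fin n are exactly the σ-orbits (via tail).  The map is connected and
-- every face is bounded by a triangle (boundary walk of length 3 through three
-- distinct vertices), so there are d/3 faces and d/2 edges; genus 0 (the
-- embedding is in the sphere/plane) is Euler's formula V - E + F = 2,
-- i.e. 6n + 2d = 3d + 12.
record PlaneTriangulation (n d : ℕ) : Set where
  field
    α σ    : Fin d → Fin d
    tail   : Fin d → Fin n
    α-invol    : ∀ x → α (α x) ≡ x
    α-fpf      : ∀ x → α x ≢ x
    σ-inj      : Injective _≡_ _≡_ σ
    tail-σ     : ∀ x → tail (σ x) ≡ tail x
    tail-orbit : ∀ x y → tail x ≡ tail y → ∃ λ k → iter k σ x ≡ y
    tail-surj  : ∀ v → ∃ λ x → tail x ≡ v
    connected  : ∀ x y → Conn α σ x y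
    face-tri   : ∀ x → σ (α (σ (α (σ (α x))))) ≡ x
    face-dist₁ : ∀ x → tail x ≢ tail (σ (α x))
    face-dist₂ : ∀ x → tail (σ (α x)) ≢ tail (σ (α (σ (α x))))
    face-dist₃ : ∀ x → tail x ≢ tail (σ (α (σ (α x))))
    euler      : 6 * n + 2 * d ≡ 3 * d + 12

module _ {n d : ℕ} (G : PlaneTriangulation n d) where
  open PlaneTriangulation G

  φ : Fin d → Fin d
  φ x = σ (α x)

  head : Fin d → Fin n
  head x = tail (α x)

  record Cycle : Set where
    field
      len      : ℕ
      dart     : Fin (suc len) → Fin d
      consec   : ∀ (i : Fin len) → head (dart (inject₁ i)) ≡ tail (dart (suc i))
      close    : head (dart (fromℕ len)) ≡ tail (dart zero)
      distinctV : Injective _≡_ _≡_ (λ i → tail (dart i))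
      distinctE : ∀ i j → i ≢ j → (dart i ≢ dart j) × (dart i ≢ α (dart j))

  open Cycle

  EdgeIn : Cycle → Fin d → Set
  EdgeIn C y = ∃ λ i → (dart C i ≡ y) ⊎ (α (dart C i) ≡ y)

  VertexIn : Cycle → Fin n → Set
  VertexIn C v = ∃ λ i → tail (dart C i) ≡ v

  EdgeDisjoint : Cycle → Cycle → Set
  EdgeDisjoint C D = ∀ j → ¬ EdgeIn C (dart D j)

  -- Reachability of darts (hence faces) without crossing edges of C:
  -- moving around a face, or crossing an edge not on C.
  data Reach (C : Cycle) (x : Fin d) : Fin d → Set where
    here  : Reach C x x
    face  : ∀ {y} → Reach C x y → Reach C x (φ y)
    cross : ∀ {y} → Reach C x y → ¬ EdgeIn C y → Reach C x (α y)

  -- With outer face = the face of dart o: D lies in the closed disk bounded by C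
  -- iff every edge of D is on C or borders faces in the bounded region of C
  -- (faces not reachable from the outer face without crossing C).
  InDisk : Fin d → Cycle → Cycle → Set
  InDisk o C D = ∀ j → EdgeIn C (dart D j) ⊎ (¬ Reach C o (dart D j) × ¬ Reach C o (α (dart D j)))

  record Nest (o : Fin d) (t : ℕ) : Set where
    field
      cyc      : Fin t → Cycle
      disjoint : ∀ i j → i ≢ j → EdgeDisjoint (cyc i) (cyc j)
      nested   : ∀ i j → toℕ j ≡ suc (toℕ i) → InDisk o (cyc i) (cyc j)

  IsSNest : ∀ {o t} → Nest o t → ℕ → Set
  IsSNest N s = Σ (Subset n) λ X → (∣ X ∣ ≡ s) ×
    (∀ i j → i ≢ j → ∀ v → (VertexIn (Nest.cyc N i) v × VertexIn (Nest.cyc N j) v) ⇔ (v ∈ₛ X))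

{-# OPTIONS --safe #-}
module Submission where

-- Fix a vertex v and take distance layers in G - v from some root. If a vertex
-- is at distance more than 4k, each layer i together with v carries a cycle C_i
-- separating the root from that vertex; these cycles meet at most in v, and half
-- of them contain v or half of them do not: a 1-nest or a 0-nest.
-- Otherwise G - v has bounded radius for every v. Applied to one v, a large
-- breadth-first tree of bounded depth has a vertex of high degree, so some v has
-- many distinct neighbours. In the breadth-first tree of G - v for this v, these
-- neighbours produce a vertex w with many paths from v to w that are disjoint
-- apart from their ends. Ordered by the rotation at v, the cycles formed by the
-- i-th path from the front and the i-th from the back give a 2-nest.
-- The Jordan curve theorem is derived from Euler's formula: with V + F + 1
-- unknowns and E + 2 equations, the integer system
-- "gradient of a + boundary of f + t · cycle = 0" has a nonzero solution.

open import Defs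
open import Data.Nat as ℕ using (ℕ; zero; suc)
import Data.Nat.Properties as ℕ
open import Data.Bool using (Bool; true; false; not; _xor_; _∧_)
import Data.Bool.Properties as Bool
open import Data.Fin as Fin using (Fin; zero; suc; toℕ; fromℕ; inject₁; inject≤; opposite; punchIn; combine; _↑ˡ_; _↑ʳ_)
import Data.Fin.Properties as Fin
open import Data.Fin.Induction using (<-weakInduction; <-weakInduction-startingFrom)
import Data.Fin.Subset.Properties as Subset
open import Data.List using (List; []; _∷_; length; filter; lookup; map; tabulate; allFin)
open import Data.List.Properties using (length-tabulate; length-map; filter-reject)
open import Data.List.Membership.Propositional.Properties using (∈-lookup)
open import Data.List.Relation.Unary.All as All using (All; []; _∷_)
open import Data.List.Relation.Unary.All.Properties as All using (all-filter)
open import Data.List.Relation.Unary.AllPairs as AllPairs using (AllPairs; []; _∷_)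
open import Data.List.Relation.Unary.AllPairs.Properties as AllPairs using ()
open import Data.List.Relation.Binary.Sublist.Propositional using (_⊆_; []; _∷_; _∷ʳ_; ⊆-refl; ⊆-trans)
open import Data.List.Relation.Binary.Sublist.Propositional.Properties using (All-resp-⊆; filter-⊆)
open import Data.List.Relation.Binary.Permutation.Propositional as ↭ using (_↭_; ↭-refl; ↭-trans; ↭-sym)
open import Data.List.Relation.Binary.Permutation.Propositional.Properties using (All-resp-↭; ↭-length)
open import Data.Product as Product using (Σ; ∃; ∃₂; _×_; _,_; proj₁; proj₂)
open import Data.Sum as Sum using (_⊎_; inj₁; inj₂; [_,_]′)
open import Data.Empty using (⊥-elim)
open import Function.Base using (_∘_)
open import Function.Bundles using (_⇔_; mk⇔; module Equivalence)
open import Relation.Nullary using (¬_; Dec; yes; no; ¬?; does)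
open import Relation.Nullary.Decidable using (_⊎-dec_; _×-dec_; dec-true; dec-false; decidable-stable)
open import Relation.Unary using (Decidable)
open import Relation.Unary.Properties using (∁?)
import Relation.Binary.Definitions as Binary
open import Relation.Binary.Definitions using (DecidableEquality; tri<; tri≈; tri>)
open import Relation.Binary.PropositionalEquality

-- Homogeneous linear systems over ℤ

-- The cycles are built without looking at the outer face. They form a chain, and the dart `o`
-- decides only at the end which of them are kept and in which direction the chain is read; this
-- costs a factor two. The other factor in `4k` is the choice between curves through `v` and curves
-- avoiding it or, for 2-nests, the pairing of paths. Deleting `v` leaves a face that need not be a
-- triangle, so neighbours of `v` may lie at very different depths and a layer of `G - v` alone need
-- not separate; this is why `v` is added to every layer. Bounded radius is wanted for every `v`
-- because the vertex with many neighbours is known only after a first tree has been searched.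
-- Parallel edges make a large degree worthless by itself, so that vertex is found through many
-- distinct children in the first tree. Inside and outside of a cycle are the two colours of a face
-- colouring that changes exactly across it. Two cycles are compared by showing that each is
-- monochromatic for the other.

module JordanCurve where

  open import Data.Integer using (ℤ; +_; -[1+_]; _+_; _*_; -_; 0ℤ; 1ℤ; ∣_∣)
  import Data.Integer as ℤ
  import Data.Integer.Properties as ℤ
  open import Data.Integer.Tactic.RingSolver using (solve-∀)
  open import Data.Nat.Tactic.RingSolver using () renaming (solve-∀ to ℕ-solve-∀)
  open import Data.Vec.Functional using (insertAt)
  open import Data.Vec.Functional.Properties using (insertAt-lookup; insertAt-punchIn)
  open import Data.Fin.Permutation using (permutation)
  open import Algebra.Properties.Semiring.Sum ℤ.+-*-semiring

  sum-zero : ∀ {n} (t : Fin n → ℤ) → (∀ i → t i ≡ 0ℤ) → sum t ≡ 0ℤ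
  sum-zero {n} t h = trans (sum-cong-≗ h) (sum-replicate-zero n)

  sum-* : ∀ {n} x (t : Fin n → ℤ) → sum (λ i → x * t i) ≡ x * sum t
  sum-* x t = sym (*-distribˡ-sum x t)

  sum-+ : ∀ {n} (s t : Fin n → ℤ) → sum (λ i → s i + t i) ≡ sum s + sum t
  sum-+ s t = ∑-distrib-+ s t

  -- Elimination without division, by induction on the number of rows. A zero first row is dropped;
  -- otherwise a nonzero pivot `a` in column `p` is cross-multiplied into the remaining rows.
  nontrivial-solution : ∀ m {N} (M : Fin m → Fin N → ℤ) → m ℕ.< N →
    ∃ λ (z : Fin N → ℤ) → (∃ λ j → z j ≢ 0ℤ) × (∀ i → sum (λ j → M i j * z j) ≡ 0ℤ)
  nontrivial-solution zero {suc N} M _ = (λ _ → 1ℤ) , (zero , λ ()) , λ ()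
  nontrivial-solution (suc m) {suc N} M (ℕ.s≤s m<N)
    with Fin.any? (λ j → ¬? (M zero j ℤ.≟ 0ℤ))
  ... | no allzero with nontrivial-solution m (λ i → M (suc i)) (ℕ.m<n⇒m<1+n m<N)
  ...   | z , nz , sol = z , nz , λ where
          zero    → sum-zero _ λ j → cong (_* z j) (decidable-stable (M zero j ℤ.≟ 0ℤ) λ ne → allzero (j , ne))
          (suc i) → sol i
  nontrivial-solution (suc m) {suc N} M (ℕ.s≤s m<N) | yes (p , Mp≢0) =
    z , (punchIn p (proj₁ nz) , z≢0) , solves
    where
    a : ℤ
    a = M zero p
    R : Fin (suc m) → Fin N → ℤ
    R i j = M i (punchIn p j)
    rec = nontrivial-solution m (λ i j → a * R (suc i) j + - (M (suc i) p) * R zero j) m<N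
    y = proj₁ rec
    nz = proj₁ (proj₂ rec)
    sol = proj₂ (proj₂ rec)
    S : Fin (suc m) → ℤ
    S i = sum (λ j → R i j * y j)
    -- Scaling the recursive solution by `a` makes the first equation solvable over the integers:
    -- `a` times the pivot coordinate has to cancel `a * S zero`.
    z : Fin (suc N) → ℤ
    z = insertAt (λ j → a * y j) p (- S zero)

    z≢0 : z (punchIn p (proj₁ nz)) ≢ 0ℤ
    z≢0 e with ℤ.i*j≡0⇒i≡0∨j≡0 a (trans (sym (insertAt-punchIn (λ j → a * y j) p (- S zero) (proj₁ nz))) e)
    ... | inj₁ a≡0 = Mp≢0 a≡0
    ... | inj₂ y≡0 = proj₂ nz y≡0

    row : ∀ i → sum (λ j → M i j * z j) ≡ M i p * - S zero + a * S i
    row i = trans (sum-remove {i = p} (λ j → M i j * z j)) (cong₂ _+_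
      (cong (M i p *_) (insertAt-lookup (λ j → a * y j) p (- S zero)))
      (trans (sum-cong-≗ λ j → trans (cong (R i j *_) (insertAt-punchIn (λ j → a * y j) p (- S zero) j))
                                     (swap (R i j) a (y j)))
             (sum-* a (λ j → R i j * y j))))
      where
      swap : ∀ r a y → r * (a * y) ≡ a * (r * y)
      swap = solve-∀

    solves : ∀ i → sum (λ j → M i j * z j) ≡ 0ℤ
    solves zero = trans (row zero) (cancel a (S zero))
      where
      cancel : ∀ a s → a * - s + a * s ≡ 0ℤ
      cancel = solve-∀
    solves (suc i) = trans (row (suc i)) (trans (sym lhs) (sol i))
      where
      expand : ∀ a r b s y → (a * r + - b * s) * y ≡ a * (r * y) + - b * (s * y)
      expand = solve-∀
      reorder : ∀ a s b s₀ → a * s + - b * s₀ ≡ b * - s₀ + a * s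
      reorder = solve-∀
      lhs : sum (λ j → (a * R (suc i) j + - (M (suc i) p) * R zero j) * y j) ≡ M (suc i) p * - S zero + a * S (suc i)
      lhs = trans (sum-cong-≗ λ j → expand a (R (suc i) j) (M (suc i) p) (R zero j) (y j))
            (trans (sum-+ (λ j → a * (R (suc i) j * y j)) (λ j → - (M (suc i) p) * (R zero j * y j)))
            (trans (cong₂ _+_ (sum-* a (λ j → R (suc i) j * y j)) (sum-* (- M (suc i) p) (λ j → R zero j * y j)))
                   (reorder a (S (suc i)) (M (suc i) p) (S zero))))

  sum-nonneg : ∀ {n} (t : Fin n → ℤ) → (∀ i → 0ℤ ℤ.≤ t i) → 0ℤ ℤ.≤ sum t
  sum-nonneg {zero} t h = ℤ.≤-refl
  sum-nonneg {suc n} t h = ℤ.+-mono-≤ (h zero) (sum-nonneg (λ i → t (suc i)) (λ i → h (suc i)))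

  square-nonneg : ∀ x → 0ℤ ℤ.≤ x * x
  square-nonneg (+ n) = subst (0ℤ ℤ.≤_) (ℤ.pos-* n n) (ℤ.+≤+ ℕ.z≤n)
  square-nonneg -[1+ n ] = ℤ.+≤+ ℕ.z≤n

  -- Definiteness of the norm is the reason to solve the system over the integers and not modulo 2,
  -- where a nonzero vector can be orthogonal to itself.
  sum-squares≡0 : ∀ {n} (t : Fin n → ℤ) → sum (λ i → t i * t i) ≡ 0ℤ → ∀ i → t i ≡ 0ℤ
  sum-squares≡0 {suc n} t e = λ where
      zero → head≡0
      (suc i) → sum-squares≡0 (λ i → t (suc i)) tail≡0 i
    where
    s = sum (λ i → t (suc i) * t (suc i))
    s≥0 : 0ℤ ℤ.≤ s
    s≥0 = sum-nonneg (λ i → t (suc i) * t (suc i)) (λ i → square-nonneg (t (suc i)))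
    split : ∀ a b → 0ℤ ℤ.≤ a → 0ℤ ℤ.≤ b → a + b ≡ 0ℤ → a ≡ 0ℤ × b ≡ 0ℤ
    split (+ zero) (+ zero) _ _ _ = refl , refl
    split (+ zero) (+ suc b) _ _ ()
    split (+ suc a) (+ b) _ _ ()
    parts = split (t zero * t zero) s (square-nonneg (t zero)) s≥0 e
    head≡0 : t zero ≡ 0ℤ
    head≡0 with ℤ.i*j≡0⇒i≡0∨j≡0 (t zero) (proj₁ parts)
    ... | inj₁ h = h
    ... | inj₂ h = h
    tail≡0 = proj₂ parts

  kron : ∀ {N} → Fin N → Fin N → ℤ
  kron zero    zero    = 1ℤ
  kron zero    (suc j) = 0ℤ
  kron (suc i) zero    = 0ℤ
  kron (suc i) (suc j) = kron i j

  kron-refl : ∀ {N} (i : Fin N) → kron i i ≡ 1ℤ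
  kron-refl zero    = refl
  kron-refl (suc i) = kron-refl i

  kron-≢ : ∀ {N} {i j : Fin N} → i ≢ j → kron i j ≡ 0ℤ
  kron-≢ {i = zero}  {zero}  ne = ⊥-elim (ne refl)
  kron-≢ {i = zero}  {suc j} ne = refl
  kron-≢ {i = suc i} {zero}  ne = refl
  kron-≢ {i = suc i} {suc j} ne = kron-≢ (ne ∘ cong suc)

  sum-kron : ∀ {N} (i : Fin N) (t : Fin N → ℤ) → sum (λ j → kron i j * t j) ≡ t i
  sum-kron zero t = trans (cong₂ _+_ (ℤ.*-identityˡ (t zero)) (sum-zero (λ j → 0ℤ * t (suc j)) λ j → refl)) (ℤ.+-identityʳ (t zero))
  sum-kron (suc i) t = trans (ℤ.+-identityˡ _) (sum-kron i (t ∘ suc))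

  sum-unique : ∀ {N} (t : Fin N → ℤ) i → (∀ j → j ≢ i → t j ≡ 0ℤ) → sum t ≡ t i
  sum-unique t i h = trans (sum-cong-≗ eq) (sum-kron i t)
    where
    eq : ∀ j → t j ≡ kron i j * t j
    eq j with i Fin.≟ j
    ... | yes refl = sym (trans (cong (_* t j) (kron-refl i)) (ℤ.*-identityˡ (t j)))
    ... | no ne = trans (h j (ne ∘ sym)) (sym (cong (_* t j) (kron-≢ ne)))

  sum-neg : ∀ {n} (t : Fin n → ℤ) → sum (λ i → - t i) ≡ - sum t
  sum-neg {zero} t = refl
  sum-neg {suc n} t = trans (cong (_+_ (- t zero)) (sum-neg (t ∘ suc))) (sym (ℤ.neg-distrib-+ (t zero) _))

  -- Linear functionals with explicit coefficients

  record Linear {N : ℕ} (L : (Fin N → ℤ) → ℤ) : Set where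
    field
      coeff : Fin N → ℤ
      eval  : ∀ z → sum (λ j → coeff j * z j) ≡ L z

  open Linear

  coord : ∀ {N} (i : Fin N) → Linear (λ z → z i)
  coord i .coeff  = kron i
  coord i .eval z = sum-kron i z

  infixl 6 _⊕_ _⊖_

  _⊕_ : ∀ {N} {L K : (Fin N → ℤ) → ℤ} → Linear L → Linear K → Linear (λ z → L z + K z)
  (l ⊕ k) .coeff j = coeff l j + coeff k j
  (l ⊕ k) .eval z =
    trans (sum-cong-≗ λ j → ℤ.*-distribʳ-+ (z j) (coeff l j) (coeff k j))
    (trans (sum-+ (λ j → coeff l j * z j) (λ j → coeff k j * z j)) (cong₂ _+_ (eval l z) (eval k z)))

  scale : ∀ {N} {L : (Fin N → ℤ) → ℤ} s → Linear L → Linear (λ z → s * L z)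
  scale s l .coeff j = s * coeff l j
  scale s l .eval z =
    trans (sum-cong-≗ λ j → ℤ.*-assoc s (coeff l j) (z j))
    (trans (sum-* s (λ j → coeff l j * z j)) (cong (s *_) (eval l z)))

  _⊖_ : ∀ {N} {L K : (Fin N → ℤ) → ℤ} → Linear L → Linear K → Linear (λ z → L z + ℤ.-1ℤ * K z)
  l ⊖ k = l ⊕ scale ℤ.-1ℤ k

  common-zero : ∀ m {N} (L : Fin m → (Fin N → ℤ) → ℤ) → (∀ i → Linear (L i)) → m ℕ.< N →
    ∃ λ (z : Fin N → ℤ) → (∃ λ j → z j ≢ 0ℤ) × (∀ i → L i z ≡ 0ℤ)
  common-zero m L lin m<N with nontrivial-solution m (λ i → coeff (lin i)) m<N
  ... | z , nz , sol = z , nz , λ i → trans (sym (eval (lin i) z)) (sol i)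

  -- Quotients of finite sets, and parity

  record Quotient {d : ℕ} (_~_ : Fin d → Fin d → Set) : Set where
    field
      size     : ℕ
      class    : Fin d → Fin size
      rep      : Fin size → Fin d
      class-rep : ∀ c → class (rep c) ≡ c
      sound    : ∀ {x y} → x ~ y → class x ≡ class y
      exact    : ∀ {x y} → class x ≡ class y → x ~ y

  -- Induction on `d`: the element `zero` joins the class of an equivalent later element if there is
  -- one, and opens a new class otherwise.
  quotient : ∀ {d} (_~_ : Fin d → Fin d → Set) → Binary.Decidable _~_ → (∀ {x} → x ~ x) →
    (∀ {x y} → x ~ y → y ~ x) → (∀ {x y z} → x ~ y → y ~ z → x ~ z) → Quotient _~_
  quotient {zero} _~_ _ _ _ _ = record
    { size = 0 ; class = λ () ; rep = λ () ; class-rep = λ () ; sound = λ { {()} } ; exact = λ { {()} } }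
  quotient {suc d} _~_ dec rfl sm tr
    with quotient (λ x y → suc x ~ suc y) (λ x y → dec (suc x) (suc y)) rfl sm tr
       | Fin.any? (λ y → dec zero (suc y))
  ... | q | yes (y , 0~y) = record
    { size = size ; class = cl ; rep = suc ∘ rep ; class-rep = class-rep ; sound = snd ; exact = ex }
    where
    open Quotient q
    cl : Fin (suc d) → Fin size
    cl zero    = class y
    cl (suc x) = class x
    snd : ∀ {x y} → x ~ y → cl x ≡ cl y
    snd {zero}  {zero}  r = refl
    snd {zero}  {suc x} r = sound (tr (sm 0~y) r)
    snd {suc x} {zero}  r = sound (tr r 0~y)
    snd {suc x} {suc x'} r = sound r
    ex : ∀ {x y} → cl x ≡ cl y → x ~ y
    ex {zero}  {zero}  r = rfl
    ex {zero}  {suc x} r = tr 0~y (exact r)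
    ex {suc x} {zero}  r = tr (exact r) (sm 0~y)
    ex {suc x} {suc x'} r = exact r
  ... | q | no new = record
    { size = suc size ; class = cl ; rep = rp ; class-rep = clr ; sound = snd ; exact = ex }
    where
    open Quotient q
    cl : Fin (suc d) → Fin (suc size)
    cl zero    = zero
    cl (suc x) = suc (class x)
    rp : Fin (suc size) → Fin (suc d)
    rp zero    = zero
    rp (suc c) = suc (rep c)
    clr : ∀ c → cl (rp c) ≡ c
    clr zero    = refl
    clr (suc c) = cong suc (class-rep c)
    snd : ∀ {x y} → x ~ y → cl x ≡ cl y
    snd {zero}  {zero}  r = refl
    snd {zero}  {suc x} r = ⊥-elim (new (x , r))
    snd {suc x} {zero}  r = ⊥-elim (new (x , sm r))
    snd {suc x} {suc x'} r = cong suc (sound r)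
    ex : ∀ {x y} → cl x ≡ cl y → x ~ y
    ex {zero}  {zero}  r = rfl
    ex {suc x} {suc x'} r = exact (Fin.suc-injective r)

  odd : ℕ → Bool
  odd zero    = false
  odd (suc k) = not (odd k)

  oddℤ : ℤ → Bool
  oddℤ q = odd ∣ q ∣

  oddℤ-suc : ∀ q → oddℤ (q + 1ℤ) ≡ not (oddℤ q)
  oddℤ-suc (+ k) = cong odd (ℕ.+-comm k 1)
  oddℤ-suc -[1+ zero ] = refl
  oddℤ-suc -[1+ suc k ] = sym (not-not (odd k))
    where
    not-not : ∀ b → not (not (not b)) ≡ not b
    not-not true  = refl
    not-not false = refl

  -- Every cycle of the triangulation separates

  module _ {n d : ℕ} (G : PlaneTriangulation n d) where
    open PlaneTriangulation G

    φ-σ : ∀ x → σ (α (α x)) ≡ σ x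
    φ-σ x = cong σ (α-invol x)

    edgeIn? : ∀ C x → Dec (EdgeIn G C x)
    edgeIn? C x = Fin.any? λ k → (Cycle.dart C k Fin.≟ x) ⊎-dec (α (Cycle.dart C k) Fin.≟ x)

    edgeIn-α : ∀ C {x} → EdgeIn G C x → EdgeIn G C (α x)
    edgeIn-α C (k , inj₁ e) = k , inj₂ (cong α e)
    edgeIn-α C (k , inj₂ e) = k , inj₁ (trans (sym (α-invol _)) (cong α e))

    -- The Jordan curve theorem modulo 2: a two-colouring of the faces, written on darts, that
    -- changes exactly across the edges of `C`.
    record Side (C : Cycle G) : Set where
      field
        side  : Fin d → Bool
        turn  : ∀ x → side (σ (α x)) ≡ side x
        flip  : ∀ {x} → EdgeIn G C x → side (α x) ≡ not (side x)
        stay  : ∀ {x} → ¬ EdgeIn G C x → side (α x) ≡ side x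

    constant-on-map : ∀ {A : Set} (f : Fin d → A) → (∀ x → f (α x) ≡ f x) → (∀ x → f (σ x) ≡ f x) → ∀ x y → f x ≡ f y
    constant-on-map f fα fσ x y = go (connected x y)
      where
      go : ∀ {y} → Conn α σ x y → f x ≡ f y
      go here = refl
      go (stepα c) = trans (go c) (sym (fα _))
      go (stepσ c) = trans (go c) (sym (fσ _))

    private
      SameEdge : Fin d → Fin d → Set
      SameEdge x y = x ≡ y ⊎ α x ≡ y

      SameFace : Fin d → Fin d → Set
      SameFace x y = x ≡ y ⊎ (σ (α x) ≡ y ⊎ σ (α (σ (α x))) ≡ y)

    edges : Quotient SameEdge
    edges = quotient SameEdge (λ x y → (x Fin.≟ y) ⊎-dec (α x Fin.≟ y)) (inj₁ refl) sm tr
      where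
      sm : ∀ {x y} → SameEdge x y → SameEdge y x
      sm (inj₁ refl) = inj₁ refl
      sm (inj₂ refl) = inj₂ (α-invol _)
      tr : ∀ {x y z} → SameEdge x y → SameEdge y z → SameEdge x z
      tr (inj₁ refl) r = r
      tr (inj₂ refl) (inj₁ refl) = inj₂ refl
      tr (inj₂ refl) (inj₂ refl) = inj₁ (sym (α-invol _))

    faces : Quotient SameFace
    faces = quotient SameFace
      (λ x y → (x Fin.≟ y) ⊎-dec ((σ (α x) Fin.≟ y) ⊎-dec (σ (α (σ (α x))) Fin.≟ y))) (inj₁ refl) sm tr
      where
      sm : ∀ {x y} → SameFace x y → SameFace y x
      sm (inj₁ refl) = inj₁ refl
      sm (inj₂ (inj₁ refl)) = inj₂ (inj₂ (face-tri _))
      sm (inj₂ (inj₂ refl)) = inj₂ (inj₁ (face-tri _))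
      tr : ∀ {x y z} → SameFace x y → SameFace y z → SameFace x z
      tr (inj₁ refl) r = r
      tr r (inj₁ refl) = r
      tr (inj₂ (inj₁ refl)) (inj₂ (inj₁ refl)) = inj₂ (inj₂ refl)
      tr (inj₂ (inj₁ refl)) (inj₂ (inj₂ refl)) = inj₁ (sym (face-tri _))
      tr (inj₂ (inj₂ refl)) (inj₂ (inj₁ refl)) = inj₁ (sym (face-tri _))
      tr (inj₂ (inj₂ refl)) (inj₂ (inj₂ refl)) = inj₂ (inj₁ (cong (σ ∘ α) (sym (face-tri _))))

    private
      module E = Quotient edges
      module F = Quotient faces

    2E≤d : E.size ℕ.* 2 ℕ.≤ d
    2E≤d = Fin.injective⇒≤ {f = end} λ {i} {j} → inj i j
      where
      pick : Fin d → Fin 2 → Fin d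
      pick x zero       = x
      pick x (suc zero) = α x
      end : Fin (E.size ℕ.* 2) → Fin d
      end i = pick (E.rep (proj₁ (Fin.remQuot {E.size} 2 i))) (proj₂ (Fin.remQuot {E.size} 2 i))
      class-pick : ∀ x s → E.class (pick x s) ≡ E.class x
      class-pick x zero       = refl
      class-pick x (suc zero) = sym (E.sound (inj₂ refl))
      pick-inj : ∀ x s t → pick x s ≡ pick x t → s ≡ t
      pick-inj x zero zero e = refl
      pick-inj x zero (suc zero) e = ⊥-elim (α-fpf x (sym e))
      pick-inj x (suc zero) zero e = ⊥-elim (α-fpf x e)
      pick-inj x (suc zero) (suc zero) e = refl
      inj′ : ∀ c s c' s' → pick (E.rep c) s ≡ pick (E.rep c') s' → (c , s) ≡ (c' , s')
      inj′ c s c' s' e with trans (sym (E.class-rep c)) (trans (sym (class-pick (E.rep c) s))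
        (trans (cong E.class e) (trans (class-pick (E.rep c') s') (E.class-rep c'))))
      ... | refl = cong (c ,_) (pick-inj (E.rep c) s s' e)
      inj : ∀ i j → end i ≡ end j → i ≡ j
      inj i j e = trans (sym (Fin.combine-remQuot {E.size} 2 i))
        (trans (cong (λ p → combine (proj₁ p) (proj₂ p)) (inj′ _ _ _ _ e)) (Fin.combine-remQuot {E.size} 2 j))

    d≤3F : d ℕ.≤ F.size ℕ.* 3
    d≤3F = Fin.injective⇒≤ {f = λ x → combine (F.class x) (corner x)} λ {x} {y} e →
        let e₁ , e₂ = Fin.combine-injective (F.class x) (corner x) (F.class y) (corner y) e
        in trans (sym (corner-pick x)) (trans (cong₂ (λ c s → pick (F.rep c) s) e₁ e₂) (corner-pick y))
      where
      pick : Fin d → Fin 3 → Fin d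
      pick x zero             = x
      pick x (suc zero)       = σ (α x)
      pick x (suc (suc zero)) = σ (α (σ (α x)))
      at : ∀ x → SameFace (F.rep (F.class x)) x
      at x = F.exact (F.class-rep (F.class x))
      index : ∀ {x y} → SameFace x y → Fin 3
      index (inj₁ _) = zero
      index (inj₂ (inj₁ _)) = suc zero
      index (inj₂ (inj₂ _)) = suc (suc zero)
      pick-index : ∀ {x y} (s : SameFace x y) → pick x (index s) ≡ y
      pick-index (inj₁ e) = e
      pick-index (inj₂ (inj₁ e)) = e
      pick-index (inj₂ (inj₂ e)) = e
      corner : Fin d → Fin 3
      corner x = index (at x)
      corner-pick : ∀ x → pick (F.rep (F.class x)) (corner x) ≡ x
      corner-pick x = pick-index (at x)

    -- Euler's formula as a dimension count, `V + F + 1 = E + 3`. The unknowns are vertex values,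
    -- face values and one multiplier; the equations are one per edge and two normalisations. The
    -- multiplier supplies the strict step.
    fewer-equations : 2 ℕ.+ E.size ℕ.< n ℕ.+ (F.size ℕ.+ 1)
    fewer-equations = ℕ.*-cancelˡ-< 6 _ _ (begin-strict
      6 ℕ.* (2 ℕ.+ E.size)             ≡⟨ l₁ E.size ⟩
      3 ℕ.* (E.size ℕ.* 2) ℕ.+ 12      ≤⟨ ℕ.+-monoˡ-≤ 12 (ℕ.*-monoʳ-≤ 3 2E≤d) ⟩
      3 ℕ.* d ℕ.+ 12                   ≡⟨ sym euler ⟩
      6 ℕ.* n ℕ.+ 2 ℕ.* d              ≤⟨ ℕ.+-monoʳ-≤ (6 ℕ.* n) (ℕ.*-monoʳ-≤ 2 d≤3F) ⟩
      6 ℕ.* n ℕ.+ 2 ℕ.* (F.size ℕ.* 3) <⟨ ℕ.m<m+n _ {6} (ℕ.s≤s ℕ.z≤n) ⟩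
      6 ℕ.* n ℕ.+ 2 ℕ.* (F.size ℕ.* 3) ℕ.+ 6 ≡⟨ l₂ n F.size ⟩
      6 ℕ.* (n ℕ.+ (F.size ℕ.+ 1))     ∎)
      where
      open ℕ.≤-Reasoning
      l₁ : ∀ e → 6 ℕ.* (2 ℕ.+ e) ≡ 3 ℕ.* (e ℕ.* 2) ℕ.+ 12
      l₁ = ℕ-solve-∀
      l₂ : ∀ m f → 6 ℕ.* m ℕ.+ 2 ℕ.* (f ℕ.* 3) ℕ.+ 6 ≡ 6 ℕ.* (m ℕ.+ (f ℕ.+ 1))
      l₂ = ℕ-solve-∀

    sum-α : ∀ (t : Fin d → ℤ) → sum (t ∘ α) ≡ sum t
    sum-α t = sym (sum-permute t (permutation α α α-invol α-invol))

    sum-φ : ∀ (t : Fin d → ℤ) → sum (λ x → t (σ (α x))) ≡ sum t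
    sum-φ t = sym (sum-permute t (permutation (σ ∘ α) (λ x → σ (α (σ (α x)))) face-tri face-tri))

    gradient : (Fin n → ℤ) → Fin d → ℤ
    gradient a x = a (tail x) + - a (tail (α x))

    gradient-α : ∀ a x → gradient a (α x) ≡ - gradient a x
    gradient-α a x = trans (cong (λ y → a (tail (α x)) + - a (tail y)) (α-invol x)) (l (a (tail x)) (a (tail (α x))))
      where
      l : ∀ p q → q + - p ≡ - (p + - q)
      l = solve-∀

    -- The head of `x` is the tail of the next dart of its face, and `f` is constant on faces, so
    -- the subtracted half of the sum is the other half reindexed by the face permutation.
    gradient⊥face : ∀ a (f : Fin d → ℤ) → (∀ x → f (σ (α x)) ≡ f x) → sum (λ x → gradient a x * f x) ≡ 0ℤ
    gradient⊥face a f fφ =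
      trans (sum-cong-≗ λ x → trans (ℤ.*-distribʳ-+ (f x) (a (tail x)) _)
              (cong (_+_ (a (tail x) * f x)) (trans (sym (ℤ.neg-distribˡ-* (a (tail (α x))) (f x)))
                (cong -_ (cong₂ _*_ (cong a (sym (tail-σ (α x)))) (sym (fφ x)))))))
      (trans (sum-+ (λ x → a (tail x) * f x) (λ x → - (a (tail (σ (α x))) * f (σ (α x)))))
      (trans (cong (_+_ (sum (λ x → a (tail x) * f x)))
                (trans (sum-neg (λ x → a (tail (σ (α x))) * f (σ (α x)))) (cong -_ (sum-φ (λ x → a (tail x) * f x)))))
             (ℤ.+-inverseʳ (sum (λ x → a (tail x) * f x)))))

    gradient⊥boundary : ∀ a (f : Fin d → ℤ) → (∀ x → f (σ (α x)) ≡ f x) →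
      sum (λ x → gradient a x * (f x + - f (α x))) ≡ 0ℤ
    gradient⊥boundary a f fφ =
      trans (sum-cong-≗ λ x → trans (ℤ.*-distribˡ-+ (gradient a x) (f x) _)
               (cong (_+_ (gradient a x * f x)) (trans (l (gradient a x) (f (α x))) (cong (_* f (α x)) (sym (gradient-α a x))))))
      (trans (sum-+ (λ x → gradient a x * f x) (λ x → gradient a (α x) * f (α x)))
      (cong₂ _+_ (gradient⊥face a f fφ) (trans (sum-α (λ x → gradient a x * f x)) (gradient⊥face a f fφ))))
      where
      l : ∀ p q → p * - q ≡ - p * q
      l = solve-∀

    module _ (C : Cycle G) where
      open Cycle C

      -- The cycle as an oriented 1-chain, antisymmetric under reversal of darts.
      chain : Fin d → ℤ
      chain x = sum (λ k → kron (dart k) x + - kron (dart k) (α x))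

      chain-α : ∀ x → chain (α x) ≡ - chain x
      chain-α x = trans (sum-cong-≗ λ k → trans (cong (λ y → kron (dart k) (α x) + - kron (dart k) y) (α-invol x))
                            (l (kron (dart k) x) (kron (dart k) (α x))))
                        (sum-neg (λ k → kron (dart k) x + - kron (dart k) (α x)))
        where
        l : ∀ p q → q + - p ≡ - (p + - q)
        l = solve-∀

      dart-inj : ∀ {i j} → dart i ≡ dart j → i ≡ j
      dart-inj e = distinctV (cong tail e)

      dart-≢-α : ∀ i j → dart i ≢ α (dart j)
      dart-≢-α i j e with i Fin.≟ j
      ... | yes refl = α-fpf (dart i) (sym e)
      ... | no ne    = proj₂ (distinctE i j ne) e

      chain-dart : ∀ i → chain (dart i) ≡ 1ℤ
      chain-dart i = trans (sum-unique _ i λ j ne →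
          cong₂ (λ p q → p + - q) (kron-≢ (ne ∘ dart-inj)) (kron-≢ (dart-≢-α j i)))
        (cong₂ (λ p q → p + - q) (kron-refl (dart i)) (kron-≢ (dart-≢-α i i)))

      chain-off : ∀ {x} → ¬ EdgeIn G C x → chain x ≡ 0ℤ
      chain-off off = sum-zero _ λ k → cong₂ (λ p q → p + - q)
        (kron-≢ λ e → off (k , inj₁ e)) (kron-≢ λ e → off (k , inj₂ (trans (cong α e) (α-invol _))))

      telescope : ∀ a → sum (λ k → gradient a (dart k)) ≡ 0ℤ
      telescope a = trans (sum-+ (λ k → a (tail (dart k))) (λ k → - a (tail (α (dart k)))))
        (trans (cong (_+_ (sum (λ k → a (tail (dart k))))) (trans (sum-neg (λ k → a (tail (α (dart k))))) (cong -_ heads)))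
               (ℤ.+-inverseʳ (sum (λ k → a (tail (dart k))))))
        where
        heads : sum (λ k → a (tail (α (dart k)))) ≡ sum (λ k → a (tail (dart k)))
        heads = trans (sum-init-last (λ k → a (tail (α (dart k)))))
          (trans (cong₂ _+_ (sum-cong-≗ {x = λ k → a (tail (α (dart (inject₁ k))))} {y = λ k → a (tail (dart (suc k)))}
                               λ i → cong a (consec i)) (cong a close))
                 (ℤ.+-comm (sum (λ k → a (tail (dart (suc k))))) (a (tail (dart zero)))))

      -- Exchanging the sums leaves twice the gradient along the cycle, once per orientation of each
      -- edge, and this telescopes around a closed walk.
      gradient⊥chain : ∀ a → sum (λ x → gradient a x * chain x) ≡ 0ℤ
      gradient⊥chain a =
        trans (sum-cong-≗ λ x → *-distribˡ-sum (gradient a x) (λ k → kron (dart k) x + - kron (dart k) (α x)))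
        (trans (∑-comm (λ x k → gradient a x * (kron (dart k) x + - kron (dart k) (α x))))
        (trans (sum-cong-≗ perDart)
        (trans (sum-+ (λ k → gradient a (dart k)) (λ k → gradient a (dart k))) (cong₂ _+_ (telescope a) (telescope a)))))
        where
        l₁ : ∀ g p q → g * (p + - q) ≡ p * g + q * - g
        l₁ = solve-∀
        perDart : ∀ k → sum (λ x → gradient a x * (kron (dart k) x + - kron (dart k) (α x)))
                        ≡ gradient a (dart k) + gradient a (dart k)
        perDart k =
          trans (sum-cong-≗ λ x → trans (l₁ (gradient a x) (kron (dart k) x) (kron (dart k) (α x)))
                   (cong (λ g → kron (dart k) x * gradient a x + kron (dart k) (α x) * g) (sym (gradient-α a x))))
          (trans (sum-+ (λ x → kron (dart k) x * gradient a x) (λ x → kron (dart k) (α x) * gradient a (α x)))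
          (cong₂ _+_ (sum-kron (dart k) (gradient a))
            (trans (sum-α (λ x → kron (dart k) x * gradient a x)) (sum-kron (dart k) (gradient a)))))

      private
        N : ℕ
        N = n ℕ.+ (F.size ℕ.+ 1)

        b : Fin d
        b = dart zero

        vertexPart : (Fin N → ℤ) → Fin n → ℤ
        vertexPart z v = z (v ↑ˡ (F.size ℕ.+ 1))

        facePart : (Fin N → ℤ) → Fin d → ℤ
        facePart z x = z (n ↑ʳ (F.class x ↑ˡ 1))

        multiplier : (Fin N → ℤ) → ℤ
        multiplier z = z (n ↑ʳ (F.size ↑ʳ zero))

        equation : Fin d → (Fin N → ℤ) → ℤ
        equation x z = (vertexPart z (tail x) + ℤ.-1ℤ * vertexPart z (tail (α x)))
                     + ((facePart z x + ℤ.-1ℤ * facePart z (α x)) + chain x * multiplier z)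

        -- The first two equations normalise at the base dart: they exclude the solutions obtained
        -- by adding a constant to all vertex values or to all face values.
        system : Fin (2 ℕ.+ E.size) → (Fin N → ℤ) → ℤ
        system zero          z = vertexPart z (tail b)
        system (suc zero)    z = facePart z b
        system (suc (suc c)) = equation (E.rep c)

        system-linear : ∀ i → Linear (system i)
        system-linear zero       = coord (tail b ↑ˡ (F.size ℕ.+ 1))
        system-linear (suc zero) = coord (n ↑ʳ (F.class b ↑ˡ 1))
        system-linear (suc (suc c)) =
          (coord (tail x ↑ˡ (F.size ℕ.+ 1)) ⊖ coord (tail (α x) ↑ˡ (F.size ℕ.+ 1)))
          ⊕ ((coord (n ↑ʳ (F.class x ↑ˡ 1)) ⊖ coord (n ↑ʳ (F.class (α x) ↑ˡ 1)))
             ⊕ scale (chain x) (coord (n ↑ʳ (F.size ↑ʳ zero))))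
          where x = E.rep c

        solution : ∃ λ (z : Fin N → ℤ) → (∃ λ j → z j ≢ 0ℤ) × (∀ i → system i z ≡ 0ℤ)
        solution = common-zero (2 ℕ.+ E.size) system system-linear fewer-equations

      -- Testing the system gradient a + ∂f + t · chain = 0 against gradient a
      -- kills a, because gradients are orthogonal to face boundaries and to cycles.
      -- Then t ≢ 0 by uniqueness, and f / t is the winding number of C.
      module Winding (z : Fin N → ℤ) (nonzero : ∃ λ j → z j ≢ 0ℤ) (solves : ∀ i → system i z ≡ 0ℤ) where
        a : Fin n → ℤ
        a = vertexPart z

        f : Fin d → ℤ
        f = facePart z

        t : ℤ
        t = multiplier z

        f-φ : ∀ x → f (σ (α x)) ≡ f x
        f-φ x = cong (λ c → z (n ↑ʳ (c ↑ˡ 1))) (sym (F.sound (inj₂ (inj₁ refl))))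

        residue : Fin d → ℤ
        residue x = gradient a x + ((f x + - f (α x)) + chain x * t)

        residue-rep : ∀ c → residue (E.rep c) ≡ 0ℤ
        residue-rep c = trans (l (a (tail x)) (a (tail (α x))) (f x) (f (α x)) (chain x * t)) (solves (suc (suc c)))
          where
          x = E.rep c
          l : ∀ p q r s u → (p + - q) + ((r + - s) + u) ≡ (p + ℤ.-1ℤ * q) + ((r + ℤ.-1ℤ * s) + u)
          l = solve-∀

        residue-α : ∀ x → residue (α x) ≡ - residue x
        residue-α x = trans (cong₂ _+_ (gradient-α a x)
            (cong₂ _+_ (cong (λ y → f (α x) + - f y) (α-invol x)) (cong (_* t) (chain-α x))))
          (l (gradient a x) (f x) (f (α x)) (chain x) t)
          where
          l : ∀ g r s c t → - g + ((s + - r) + - c * t) ≡ - (g + ((r + - s) + c * t))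
          l = solve-∀

        -- The system speaks of one representative dart per edge; antisymmetry of the residue gives
        -- the reverse dart.
        residue≡0 : ∀ x → residue x ≡ 0ℤ
        residue≡0 x with E.exact (E.class-rep (E.class x))
        ... | inj₁ e = trans (cong residue (sym e)) (residue-rep (E.class x))
        ... | inj₂ e = trans (cong residue (sym e)) (trans (residue-α _) (cong -_ (residue-rep (E.class x))))

        gradient-norm : sum (λ x → gradient a x * gradient a x) ≡ 0ℤ
        gradient-norm =
          trans (sum-cong-≗ λ x → l (gradient a x) (f x + - f (α x)) (chain x) t (residue≡0 x))
          (trans (sum-+ (λ x → - (gradient a x * (f x + - f (α x)))) (λ x → - t * (gradient a x * chain x)))
          (cong₂ _+_ (trans (sum-neg (λ x → gradient a x * (f x + - f (α x)))) (cong -_ (gradient⊥boundary a f f-φ)))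
                     (trans (sum-* (- t) (λ x → gradient a x * chain x))
                       (trans (cong (_*_ (- t)) (gradient⊥chain a)) (ℤ.*-zeroʳ (- t))))))
          where
          l₁ : ∀ g h c t → g * g ≡ g * (g + (h + c * t)) + (- (g * h) + - t * (g * c))
          l₁ = solve-∀
          l : ∀ g h c t → g + (h + c * t) ≡ 0ℤ → g * g ≡ - (g * h) + - t * (g * c)
          l g h c t e = trans (l₁ g h c t) (trans (cong (λ r → g * r + (- (g * h) + - t * (g * c))) e)
            (trans (cong (_+ (- (g * h) + - t * (g * c))) (ℤ.*-zeroʳ g)) (ℤ.+-identityˡ _)))

        gradient≡0 : ∀ x → gradient a x ≡ 0ℤ
        gradient≡0 = sum-squares≡0 (gradient a) gradient-norm

        a≡0 : ∀ v → a v ≡ 0ℤ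
        a≡0 v with tail-surj v
        ... | x , refl = trans (constant-on-map (a ∘ tail)
                (λ x → sym (ℤ.i-j≡0⇒i≡j (a (tail x)) (a (tail (α x))) (gradient≡0 x)))
                (λ x → cong a (tail-σ x)) x b) (solves zero)

        jump : ∀ x → f x + chain x * t ≡ f (α x)
        jump x = ℤ.i-j≡0⇒i≡j _ _ (trans (l (f x) (f (α x)) (chain x * t))
            (trans (sym (ℤ.+-identityˡ _)) (trans (cong (_+ ((f x + - f (α x)) + chain x * t)) (sym (gradient≡0 x))) (residue≡0 x))))
          where
          l : ∀ r s u → (r + u) + - s ≡ (r + - s) + u
          l = solve-∀

        t≢0 : t ≢ 0ℤ
        t≢0 t≡0 = proj₂ nonzero (z≡0 (proj₁ nonzero))
          where
          f-α : ∀ x → f (α x) ≡ f x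
          f-α x = trans (sym (jump x)) (trans (cong (λ t → f x + chain x * t) t≡0)
                    (trans (cong (_+_ (f x)) (ℤ.*-zeroʳ (chain x))) (ℤ.+-identityʳ (f x))))
          f≡0 : ∀ x → f x ≡ 0ℤ
          f≡0 x = trans (constant-on-map f f-α (λ x → trans (cong f (sym (φ-σ x))) (trans (f-φ (α x)) (f-α x))) x b)
                        (solves (suc zero))
          z≡0 : ∀ j → z j ≡ 0ℤ
          z≡0 j with Fin.splitAt n j in eq
          ... | inj₁ v = trans (cong z (sym (Fin.splitAt⁻¹-↑ˡ eq))) (a≡0 v)
          ... | inj₂ j' with Fin.splitAt F.size j' in eq'
          ...   | inj₁ c = trans (cong z (sym (Fin.splitAt⁻¹-↑ʳ eq)))
                    (trans (cong (λ i → z (n ↑ʳ i)) (sym (Fin.splitAt⁻¹-↑ˡ eq')))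
                    (trans (cong (λ i → z (n ↑ʳ (i ↑ˡ 1))) (sym (F.class-rep c))) (f≡0 (F.rep c))))
          ...   | inj₂ zero = trans (cong z (sym (Fin.splitAt⁻¹-↑ʳ eq)))
                    (trans (cong (λ i → z (n ↑ʳ i)) (sym (Fin.splitAt⁻¹-↑ʳ eq'))) t≡0)

        -- Along a connection from `b`, turning inside a face keeps `f`, and crossing an edge adds a
        -- multiple of `t`. The quotient by `t` is thus collected step by step, without division.
        winding : ∀ x → ∃ λ q → f x ≡ f b + q * t
        winding x = go (connected b x)
          where
          l : ∀ r q c t → (r + q * t) + c * t ≡ r + (q + c) * t
          l = solve-∀
          across : ∀ x → (∃ λ q → f x ≡ f b + q * t) → ∃ λ q → f (α x) ≡ f b + q * t
          across x (q , e) = q + chain x , trans (sym (jump x)) (trans (cong (_+ (chain x * t)) e) (l (f b) q (chain x) t))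
          go : ∀ {x} → Conn α σ b x → ∃ λ q → f x ≡ f b + q * t
          go here = 0ℤ , sym (ℤ.+-identityʳ (f b))
          go (stepα {y} c) = across y (go c)
          go (stepσ {y} c) = proj₁ next , trans (cong f (sym (φ-σ y))) (trans (f-φ (α y)) (proj₂ next))
            where next = across y (go c)

        q : Fin d → ℤ
        q x = proj₁ (winding x)

        -- The number `q x` was read off from some path; cancelling `t` shows that it depends on
        -- `f x` alone, so the laws of `f` for turning and crossing pass to `q`.
        q-unique : ∀ {x r} → f x ≡ f b + r * t → q x ≡ r
        q-unique {x} {r} e = ℤ.*-cancelʳ-≡ (q x) r t {{ℤ.≢-nonZero t≢0}}
          (∙-cancelˡ (f b) (q x * t) (r * t) (trans (sym (proj₂ (winding x))) e))
          where
          ∙-cancelˡ : ∀ p u v → p + u ≡ p + v → u ≡ v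
          ∙-cancelˡ p u v e = trans (l p u) (trans (cong (_+_ (- p)) e) (sym (l p v)))
            where
            l : ∀ p u → u ≡ - p + (p + u)
            l = solve-∀

        q-φ : ∀ x → q (σ (α x)) ≡ q x
        q-φ x = q-unique (trans (f-φ x) (proj₂ (winding x)))

        q-α : ∀ x → q (α x) ≡ q x + chain x
        q-α x = q-unique (trans (sym (jump x)) (trans (cong (_+ (chain x * t)) (proj₂ (winding x))) (l (f b) (q x) (chain x) t)))
          where
          l : ∀ r q c t → (r + q * t) + c * t ≡ r + (q + c) * t
          l = solve-∀

      abstract
        -- The colour is the parity of the winding number, which changes by one across an edge of
        -- the cycle and stays the same across any other edge.
        jordan : Side C
        jordan = record
          { side = oddℤ ∘ q
          ; turn = cong oddℤ ∘ q-φ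
          ; flip = flips
          ; stay = λ {x} off → cong oddℤ (trans (q-α x) (trans (cong (_+_ (q x)) (chain-off off)) (ℤ.+-identityʳ (q x))))
          }
          where
          open Winding (proj₁ solution) (proj₁ (proj₂ solution)) (proj₂ (proj₂ solution))
          forward : ∀ k → oddℤ (q (α (dart k))) ≡ not (oddℤ (q (dart k)))
          forward k = trans (cong oddℤ (trans (q-α (dart k)) (cong (_+_ (q (dart k))) (chain-dart k)))) (oddℤ-suc (q (dart k)))
          flips : ∀ {x} → EdgeIn G C x → oddℤ (q (α x)) ≡ not (oddℤ (q x))
          flips (k , inj₁ refl) = forward k
          flips (k , inj₂ refl) = trans (cong (oddℤ ∘ q) (α-invol (dart k)))
            (trans (sym (Bool.not-involutive _)) (cong not (sym (forward k))))

open JordanCurve using (module Side; Side; φ-σ; edgeIn?; edgeIn-α; constant-on-map; jordan)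
open import Data.Nat using (_+_; _*_; _∸_; _≤_; _<_; z≤n; s≤s)
open import Data.Fin.Subset using (Subset; ∣_∣; ⁅_⁆; ⊥; _∪_) renaming (_∈_ to _∈ₛ_)

-- Separating cycles inside the boundary of a set of faces

least : ∀ {P : ℕ → Set} → Decidable P → ∀ {m} → P m → ∃ λ l → P l × (∀ {k} → k < l → ¬ P k)
least P? {m} p with P? 0
... | yes p₀ = 0 , p₀ , λ ()
least P? {zero}  p | no ¬p₀ = ⊥-elim (¬p₀ p)
least P? {suc m} p | no ¬p₀ with least (P? ∘ suc) p
... | l , pl , min = suc l , pl , λ { {zero} _ → ¬p₀ ; {suc k} (s≤s k<l) → min k<l }

count : ∀ {d} → (Fin d → Bool) → ℕ
count {zero}  p = 0
count {suc d} p = bit (p zero) + count (p ∘ suc)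
  where
  bit : Bool → ℕ
  bit true  = 1
  bit false = 0

count-≤ : ∀ {d} {p q : Fin d → Bool} → (∀ x → p x ≡ true → q x ≡ true) → count p ≤ count q
count-≤ {zero} h = z≤n
count-≤ {suc d} {p} {q} h with p zero in ep | q zero in eq
... | true  | true  = s≤s (count-≤ (h ∘ suc))
... | true  | false with () ← trans (sym eq) (h zero ep)
... | false | true  = ℕ.m≤n⇒m≤1+n (count-≤ (h ∘ suc))
... | false | false = count-≤ (h ∘ suc)

count-< : ∀ {d} {p q : Fin d → Bool} → (∀ x → p x ≡ true → q x ≡ true) →
  ∀ y → p y ≡ false → q y ≡ true → count p < count q
count-< {suc d} {p} {q} h zero py qy rewrite py | qy = s≤s (count-≤ (h ∘ suc))
count-< {suc d} {p} {q} h (suc y) py qy with p zero in ep | q zero in eq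
... | true  | true  = s≤s (count-< (h ∘ suc) y py qy)
... | true  | false with () ← trans (sym eq) (h zero ep)
... | false | true  = ℕ.m<n⇒m<1+n (count-< (h ∘ suc) y py qy)
... | false | false = count-< (h ∘ suc) y py qy

module _ {n d : ℕ} (G : PlaneTriangulation n d) where
  open PlaneTriangulation G

  no-loop : ∀ x → tail x ≢ tail (α x)
  no-loop x e = face-dist₁ x (trans e (sym (tail-σ (α x))))

  tail-iter : ∀ k x → tail (iter k σ x) ≡ tail x
  tail-iter zero    x = refl
  tail-iter (suc k) x = trans (tail-σ _) (tail-iter k x)

  -- Indexing by natural numbers keeps `Fin` arithmetic out of the constructions. The last
  -- hypothesis excludes going along one edge and straight back, which distinct vertices alone would
  -- allow.
  cycleOf : (len : ℕ) (s : ℕ → Fin d) →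
    (∀ k → k < len → tail (α (s k)) ≡ tail (s (suc k))) → tail (α (s len)) ≡ tail (s 0) →
    (∀ {a b} → a < b → b ≤ len → tail (s a) ≢ tail (s b)) →
    (∀ {a b} → a ≤ len → b ≤ len → s a ≢ α (s b)) → Cycle G
  cycleOf len s step closes distinct antisym = record
    { len = len
    ; dart = s ∘ toℕ
    ; consec = λ i → trans (cong (λ k → tail (α (s k))) (Fin.toℕ-inject₁ i)) (step (toℕ i) (Fin.toℕ<n i))
    ; close = trans (cong (λ k → tail (α (s k))) (Fin.toℕ-fromℕ len)) closes
    ; distinctV = λ {i} {j} → distinctV i j
    ; distinctE = λ i j i≢j → i≢j ∘ distinctV i j ∘ cong tail , antisym (bound i) (bound j)
    }
    where
    bound : ∀ (i : Fin (suc len)) → toℕ i ≤ len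
    bound i = ℕ.≤-pred (Fin.toℕ<n i)
    distinctV : ∀ i j → tail (s (toℕ i)) ≡ tail (s (toℕ j)) → i ≡ j
    distinctV i j e with ℕ.<-cmp (toℕ i) (toℕ j)
    ... | tri< i<j _ _ = ⊥-elim (distinct i<j (bound j) e)
    ... | tri≈ _ i≡j _ = Fin.toℕ-injective i≡j
    ... | tri> _ _ j<i = ⊥-elim (distinct j<i (bound i) (sym e))

  module _ (A : Fin d → Bool) (A-turn : ∀ x → A (σ (α x)) ≡ A x) where

    A-σ : ∀ x → A (σ x) ≡ A (α x)
    A-σ x = trans (cong A (sym (φ-σ G x))) (A-turn (α x))

    Out : Fin d → Set
    Out x = A x ≡ true × A (α x) ≡ false

    leaves : ∀ k y → A y ≡ true → A (iter k σ y) ≡ false →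
      ∃ λ w → tail w ≡ tail y × Out w
    leaves zero y t f with () ← trans (sym t) f
    leaves (suc k) y t f with A (iter k σ y) in eq
    ... | false = leaves k y t eq
    ... | true  = iter k σ y , tail-iter k y , eq , trans (sym (A-σ (iter k σ y))) f

    -- At the head of `x`, rotate from `σ (α x)`, which lies in the face of `x` and so in `A`, to
    -- `α x`, which lies outside. Somewhere the rotation leaves `A`, and there the boundary
    -- continues.
    next : ∀ x → Out x → ∃ λ y → tail y ≡ tail (α x) × Out y
    next x (t , f) with tail-orbit (σ (α x)) (α x) (tail-σ (α x))
    ... | k , e with leaves k (σ (α x)) (trans (A-turn x) t) (trans (cong A e) f)
    ...   | y , ty , o = y , trans ty (tail-σ (α x)) , o

    -- Iterating `next` must revisit a vertex, and stopping at the first revisit makes the closed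
    -- part simple. No edge is used in both directions, since the reverse of an outgoing dart lies
    -- outside `A`.
    boundary-cycle : ∃ Out → ∃ λ C → ∀ k → Out (Cycle.dart {G = G} C k)
    boundary-cycle start = C , λ k → proj₂ (s (i + toℕ k))
      where
      s : ℕ → ∃ Out
      s zero    = start
      s (suc k) = let y , _ , o = next (proj₁ (s k)) (proj₂ (s k)) in y , o
      x : ℕ → Fin d
      x k = proj₁ (s k)
      follows : ∀ k → tail (α (x k)) ≡ tail (x (suc k))
      follows k = sym (proj₁ (proj₂ (next (proj₁ (s k)) (proj₂ (s k)))))
      Repeats : ℕ → Set
      Repeats j = ∃ λ (i : Fin j) → tail (x (toℕ i)) ≡ tail (x j)
      repeats : ∃ Repeats
      repeats with Fin.pigeonhole (ℕ.n<1+n n) (λ (k : Fin (suc n)) → tail (x (toℕ k)))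
      ... | i , j , i<j , e = toℕ j , Fin.fromℕ< i<j , trans (cong (tail ∘ x) (Fin.toℕ-fromℕ< i<j)) e
      first : ∃ λ l → Repeats l × (∀ {k} → k < l → ¬ Repeats k)
      first = least (λ j → Fin.any? λ i → tail (x (toℕ i)) Fin.≟ tail (x j)) (proj₂ repeats)
      j = proj₁ first
      i = toℕ (proj₁ (proj₁ (proj₂ first)))
      tails : tail (x i) ≡ tail (x j)
      tails = proj₂ (proj₁ (proj₂ first))
      -- The darts used are those at positions from `i` to `j - 1`; a cycle with field `len` has
      -- `suc len` darts.
      gap : ∃ λ len → suc i + len ≡ j
      gap = ℕ.m≤n⇒∃[o]m+o≡n (Fin.toℕ<n (proj₁ (proj₁ (proj₂ first))))
      len = proj₁ gap
      distinct : ∀ {a b} → a < b → b ≤ len → tail (x (i + a)) ≢ tail (x (i + b))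
      distinct {a} {b} a<b b≤len e = proj₂ (proj₂ first) i+b<j
        (Fin.fromℕ< i+a<i+b , trans (cong (tail ∘ x) (Fin.toℕ-fromℕ< i+a<i+b)) e)
        where
        i+a<i+b : i + a < i + b
        i+a<i+b = ℕ.+-monoʳ-< i a<b
        i+b<j : i + b < j
        i+b<j = subst (i + b <_) (proj₂ gap) (s≤s (ℕ.+-monoʳ-≤ i b≤len))
      antisym : ∀ {a b} → a ≤ len → b ≤ len → x (i + a) ≢ α (x (i + b))
      antisym {a} {b} _ _ e with () ← trans (sym (proj₁ (proj₂ (s (i + a)))))
                                    (trans (cong A e) (proj₂ (proj₂ (s (i + b)))))
      C : Cycle G
      C = cycleOf len (λ k → x (i + k))
        (λ k _ → trans (follows (i + k)) (cong (tail ∘ x) (sym (ℕ.+-suc i k))))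
        (trans (follows (i + len)) (trans (cong (tail ∘ x) (proj₂ gap)) (trans (sym tails)
          (cong (tail ∘ x) (sym (ℕ.+-identityʳ i))))))
        distinct antisym

  SeparatesWithin : (Fin d → Bool) → Fin d → Fin d → Set
  SeparatesWithin A x y = ∃ λ C → Σ (Side G C) λ S →
    Side.side S x ≢ Side.side S y × (∀ {e} → EdgeIn G C e → A e ≢ A (α e))

  private
    xor-cancelʳ : ∀ a b c → a xor c ≡ b xor c → a ≡ b
    xor-cancelʳ true  true  c     e = refl
    xor-cancelʳ false false c     e = refl
    xor-cancelʳ true  false true  ()
    xor-cancelʳ true  false false ()
    xor-cancelʳ false true  true  ()
    xor-cancelʳ false true  false ()

    xor-≢ : ∀ {a b} → a ≢ b → a xor b ≡ true
    xor-≢ {true}  {true}  ne = ⊥-elim (ne refl)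
    xor-≢ {true}  {false} ne = refl
    xor-≢ {false} {true}  ne = refl
    xor-≢ {false} {false} ne = ⊥-elim (ne refl)

    xor-not : ∀ a b c → a ≢ b → (a xor c) xor (b xor not c) ≡ false
    xor-not true  true  c     ne = ⊥-elim (ne refl)
    xor-not true  false true  ne = refl
    xor-not true  false false ne = refl
    xor-not false true  true  ne = refl
    xor-not false true  false ne = refl
    xor-not false false c     ne = ⊥-elim (ne refl)

    xor-same : ∀ a b c → (a xor c) xor (b xor c) ≡ a xor b
    xor-same true  true  true  = refl
    xor-same true  true  false = refl
    xor-same true  false true  = refl
    xor-same true  false false = refl
    xor-same false true  true  = refl
    xor-same false true  false = refl
    xor-same false false true  = refl
    xor-same false false false = refl

  boundary : (Fin d → Bool) → Fin d → Bool
  boundary A x = A x xor A (α x)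

  private
    -- The boundary of `A` decomposes modulo 2 into cycles. If the cycle found does not separate `x`
    -- from `y`, adding its colouring to `A` removes that cycle from the boundary and still
    -- distinguishes `x` from `y`, so induction on the boundary size applies.
    extract : ∀ m A → count (boundary A) < m → (∀ x → A (σ (α x)) ≡ A x) →
      ∀ x y → A x ≢ A y → SeparatesWithin A x y
    extract (suc m) A (s≤s bound) A-turn x y Ax≢Ay = finish (boundary-cycle A A-turn start)
      where
      start : ∃ (Out A A-turn)
      start with Fin.any? (λ e → ¬? (A (α e) Bool.≟ A e))
      ... | no flat = ⊥-elim (Ax≢Ay (constant-on-map G A flat′ (λ e → trans (A-σ A A-turn e) (flat′ e)) x y))
        where
        flat′ : ∀ e → A (α e) ≡ A e
        flat′ e = decidable-stable (A (α e) Bool.≟ A e) λ ne → flat (e , ne)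
      ... | yes (e , ne) with A e in e₁ | A (α e) in e₂
      ...   | true  | true  = ⊥-elim (ne refl)
      ...   | true  | false = e , e₁ , e₂
      ...   | false | true  = α e , e₂ , trans (cong A (α-invol e)) e₁
      ...   | false | false = ⊥-elim (ne refl)

      finish : (∃ λ C → ∀ k → Out A A-turn (Cycle.dart {G = G} C k)) → SeparatesWithin A x y
      finish (C , out) = decide (Side.side S x Bool.≟ Side.side S y)
        where
        S : Side G C
        S = jordan G C
        open Side S
        within : ∀ {e} → EdgeIn G C e → A e ≢ A (α e)
        within (k , inj₁ refl) eq with () ← trans (sym (proj₁ (out k))) (trans eq (proj₂ (out k)))
        within (k , inj₂ refl) eq with () ← trans (sym (proj₁ (out k)))
          (trans (cong A (sym (α-invol _))) (trans (sym eq) (proj₂ (out k))))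
        A' : Fin d → Bool
        A' e = A e xor side e
        on : ∀ {e} → EdgeIn G C e → boundary A' e ≡ false
        on {e} i = trans (cong (λ s → (A e xor side e) xor (A (α e) xor s)) (flip i)) (xor-not (A e) (A (α e)) (side e) (within i))
        off : ∀ {e} → ¬ EdgeIn G C e → boundary A' e ≡ boundary A e
        off {e} i = trans (cong (λ s → (A e xor side e) xor (A (α e) xor s)) (stay i)) (xor-same (A e) (A (α e)) (side e))
        smaller : ∀ e → boundary A' e ≡ true → boundary A e ≡ true
        smaller e b with edgeIn? G C e
        ... | yes i with () ← trans (sym b) (on i)
        ... | no i = trans (sym (off i)) b
        e₀ : EdgeIn G C (Cycle.dart C zero)
        e₀ = zero , inj₁ refl
        decide : Dec (side x ≡ side y) → SeparatesWithin A x y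
        decide (no ne) = C , S , ne , within
        decide (yes eq) with extract m A'
          (ℕ.<-≤-trans (count-< smaller (Cycle.dart C zero) (on e₀) (xor-≢ (within e₀))) bound)
          (λ e → cong₂ _xor_ (A-turn e) (turn e)) x y
          (λ e → Ax≢Ay (xor-cancelʳ (A x) (A y) (side y) (trans (cong (A x xor_) (sym eq)) e)))
        ... | C' , S' , sep , within' = C' , S' , sep , λ {e} i eq' → within' i
          (boundary-false A' (trans (off λ j → within j eq') (trans (cong (_xor A (α e)) eq') (Bool.xor-same (A (α e))))))
          where
          boundary-false : ∀ B {e} → boundary B e ≡ false → B e ≡ B (α e)
          boundary-false B {e} f with B e | B (α e)
          ... | true  | true  = refl
          ... | false | false = refl

  abstract
    separating-cycle : ∀ A → (∀ x → A (σ (α x)) ≡ A x) → ∀ x y → A x ≢ A y → SeparatesWithin A x y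
    separating-cycle A = extract (suc (count (boundary A))) A ℕ.≤-refl

-- Nested families of closed curves

module _ {A : Set} where

  lookup-pairs : ∀ {R : A → A → Set} {xs} → AllPairs R xs → ∀ {i j} → i Fin.< j → R (lookup xs i) (lookup xs j)
  lookup-pairs (r ∷ rs) {zero}  {suc j} _         = All.lookup r (∈-lookup j)
  lookup-pairs (r ∷ rs) {suc i} {suc j} (s≤s i<j) = lookup-pairs rs i<j

  module _ {P : A → Set} (P? : Decidable P) where

    length-split : ∀ xs → length (filter P? xs) + length (filter (∁? P?) xs) ≡ length xs
    length-split [] = refl
    length-split (x ∷ xs) with P? x
    ... | yes p = cong suc (length-split xs)
    ... | no ¬p = trans (ℕ.+-suc _ _) (cong suc (length-split xs))

    majority : ∀ k xs → k + k ≤ length xs → k ≤ length (filter P? xs) ⊎ k ≤ length (filter (∁? P?) xs)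
    majority k xs h with k ℕ.≤? length (filter P? xs)
    ... | yes k≤ = inj₁ k≤
    ... | no k≰  = inj₂ (ℕ.+-cancelˡ-≤ k _ _ (ℕ.≤-trans h (ℕ.≤-trans (ℕ.≤-reflexive (sym (length-split xs)))
                     (ℕ.+-monoˡ-≤ _ (ℕ.<⇒≤ (ℕ.≰⇒> k≰))))))

module _ {n d : ℕ} (G : PlaneTriangulation n d) where
  open PlaneTriangulation G

  record Curve : Set where
    field
      cycle : Cycle G
      sides : Side G cycle
    open Side sides public

  open Curve

  HasNest : Fin d → ℕ → ℕ → Set
  HasNest o s k = ∃ λ t → k ≤ t × Σ (Nest G o t) (λ C → IsSNest G C s)

  -- An order of curves that does not mention the outer face: exchanging the colours of both curves
  -- reverses it. According to the side of `o`, either `inner` or `outer` provides the nesting.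
  record Precedes (X : Subset n) (D D' : Curve) : Set where
    field
      inner  : ∀ {y} → EdgeIn G (cycle D') y → side D y ≡ true
      outer  : ∀ {y} → EdgeIn G (cycle D) y → side D' y ≡ false
      common : ∀ v → (VertexIn G (cycle D) v × VertexIn G (cycle D') v) ⇔ (v ∈ₛ X)

  open Precedes

  reach-side : ∀ D {o y} → Reach G (cycle D) o y → side D y ≡ side D o
  reach-side D here = refl
  reach-side D (face {y} r) = trans (turn D y) (reach-side D r)
  reach-side D (cross r off) = trans (stay D off) (reach-side D r)

  -- Moves that do not cross `D` preserve its colour, so darts of the colour opposite to `o` are
  -- never reached. The colour is a parameter because the chain may be read in both directions.
  beyond : ∀ D D' {o b} → side D o ≡ not b → (∀ {y} → EdgeIn G (cycle D') y → side D y ≡ b) →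
    InDisk G o (cycle D) (cycle D')
  beyond D D' {o} {b} so sy j = inj₂ (unreached e , unreached (edgeIn-α G (cycle D') e))
    where
    e : EdgeIn G (cycle D') (Cycle.dart (cycle D') j)
    e = j , inj₁ refl
    unreached : ∀ {y} → EdgeIn G (cycle D') y → ¬ Reach G (cycle D) o y
    unreached i r = Bool.not-¬ refl (trans (sym (sy i)) (trans (reach-side D r) so))

  edge-disjoint : ∀ {D D' b} → (∀ {y} → EdgeIn G (cycle D') y → side D y ≡ b) → EdgeDisjoint G (cycle D) (cycle D')
  edge-disjoint {D} {D'} {b} h j i = Bool.not-¬ refl
      (trans (sym (h (edgeIn-α G (cycle D') e))) (trans (flip D i) (cong not (h e))))
    where
    e : EdgeIn G (cycle D') (Cycle.dart (cycle D') j)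
    e = j , inj₁ refl

  nestOf : ∀ o X {t} (D : Fin t → Curve) →
    (∀ {i j} → i Fin.< j → InDisk G o (cycle (D i)) (cycle (D j)) × (Precedes X (D i) (D j) ⊎ Precedes X (D j) (D i))) →
    Σ (Nest G o t) λ C → IsSNest G C ∣ X ∣
  nestOf o X {t} D h = record { cyc = cycle ∘ D ; disjoint = λ i j ne → disj (any i j ne) ; nested = λ i j e → proj₁ (h (ℕ.≤-reflexive (sym e))) }
    , X , refl , λ i j ne → comm (any i j ne)
    where
    any : ∀ i j → i ≢ j → Precedes X (D i) (D j) ⊎ Precedes X (D j) (D i)
    any i j ne with Fin.<-cmp i j
    ... | tri< i<j _ _ = proj₂ (h i<j)
    ... | tri≈ _ i≡j _ = ⊥-elim (ne i≡j)
    ... | tri> _ _ j<i with proj₂ (h j<i)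
    ...   | inj₁ p = inj₂ p
    ...   | inj₂ p = inj₁ p
    disj : ∀ {i j} → Precedes X (D i) (D j) ⊎ Precedes X (D j) (D i) → EdgeDisjoint G (cycle (D i)) (cycle (D j))
    disj {i} {j} (inj₁ p) = edge-disjoint {D i} {D j} (inner p)
    disj {i} {j} (inj₂ p) = edge-disjoint {D i} {D j} (outer p)
    comm : ∀ {i j} → Precedes X (D i) (D j) ⊎ Precedes X (D j) (D i) →
      ∀ v → (VertexIn G (cycle (D i)) v × VertexIn G (cycle (D j)) v) ⇔ (v ∈ₛ X)
    comm (inj₁ p) v = common p v
    comm (inj₂ p) v = mk⇔ (Equivalence.to (common p v) ∘ Product.swap) (Product.swap ∘ Equivalence.from (common p v))

  -- Depending on which side of the curves o lies, the family is nested in the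
  -- given or in the reverse order; one of the two halves is large.
  family⇒nest : ∀ o X k Ds → AllPairs (Precedes X) Ds → k + k ≤ length Ds → HasNest o ∣ X ∣ k
  family⇒nest o X k Ds pairs long with majority (λ D → side D o Bool.≟ false) k Ds long
  ... | inj₁ k≤ = length Es , k≤ , nestOf o X (lookup Es) λ {i} {j} i<j →
          let p = lookup-pairs (AllPairs.filter⁺ P? pairs) i<j
          in beyond (lookup Es i) (lookup Es j) (All.lookup (all-filter P? Ds) (∈-lookup i)) (inner p) , inj₁ p
    where
    P? : Decidable (λ D → side D o ≡ false)
    P? D = side D o Bool.≟ false
    Es = filter P? Ds
  ... | inj₂ k≤ = length Es , k≤ , nestOf o X (lookup Es ∘ opposite) λ {i} {j} i<j →
          let p = lookup-pairs (AllPairs.filter⁺ P? pairs) (opposite-< i<j)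
          in beyond (lookup Es (opposite i)) (lookup Es (opposite j))
               (Bool.¬-not (All.lookup (all-filter P? Ds) (∈-lookup (opposite i)))) (outer p) , inj₂ p
    where
    P? : Decidable (λ D → side D o ≢ false)
    P? = ∁? (λ D → side D o Bool.≟ false)
    Es = filter P? Ds
    opposite-< : ∀ {t} {i j : Fin t} → i Fin.< j → opposite j Fin.< opposite i
    opposite-< {t} {i} {j} i<j = subst₂ _<_ (sym (Fin.opposite-prop j)) (sym (Fin.opposite-prop i))
      (ℕ.∸-monoʳ-< (s≤s i<j) (Fin.toℕ<n j))

-- Distance layers around a vertex of G - v

allPairs-with : ∀ {A : Set} {P : A → Set} {R S : A → A → Set} → (∀ {x y} → P x → P y → R x y → S x y) →
  ∀ {xs} → All P xs → AllPairs R xs → AllPairs S xs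
allPairs-with f [] [] = []
allPairs-with f (p ∷ ps) (r ∷ rs) = All.zipWith (λ (q , r) → f p q r) (ps , r) ∷ allPairs-with f ps rs

module _ {n d : ℕ} (G : PlaneTriangulation n d) where
  open PlaneTriangulation G
  open Curve

  third-head : ∀ x → tail (α (σ (α (σ (α x))))) ≡ tail x
  third-head x = trans (sym (tail-σ _)) (cong tail (face-tri x))

  -- Since `b` is arbitrary, the induction runs from `b` to the last dart, passes through the
  -- closing step to `zero`, and starts again from there.
  around : (C : Cycle G) (P : Fin (suc (Cycle.len C)) → Set) →
    (∀ k k' → tail (α (Cycle.dart C k)) ≡ tail (Cycle.dart C k') → P k → P k') → ∀ b → P b → ∀ k → P k
  around C P step b pb = <-weakInduction P (step (fromℕ len) zero close last) up
    where
    open Cycle C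
    up : ∀ i → P (inject₁ i) → P (suc i)
    up i = step (inject₁ i) (suc i) (consec i)
    last : P (fromℕ len)
    last = <-weakInduction-startingFrom P pb up (Fin.≤fromℕ b)

  dart-after : (C : Cycle G) → ∀ k → ∃ λ k' → tail (α (Cycle.dart C k)) ≡ tail (Cycle.dart C k')
  dart-after C k with toℕ k ℕ.≟ Cycle.len C
  ... | yes e = zero , trans (cong (tail ∘ α ∘ dart) (Fin.toℕ-injective (trans e (sym (Fin.toℕ-fromℕ len))))) close
    where open Cycle C
  ... | no ne = suc (Fin.lower₁ k (ne ∘ sym)) ,
      trans (cong (tail ∘ α ∘ dart) (sym (Fin.inject₁-lower₁ k (ne ∘ sym)))) (consec _)
    where open Cycle C

  edge⇒vertex : (C : Cycle G) → ∀ {x} → EdgeIn G C x → VertexIn G C (tail x)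
  edge⇒vertex C (k , inj₁ e) = k , cong tail e
  edge⇒vertex C (k , inj₂ e) with dart-after C k
  ... | k' , e' = k' , trans (sym e') (cong tail e)

  vertexIn? : (C : Cycle G) → Decidable (VertexIn G C)
  vertexIn? C u = Fin.any? λ k → tail (Cycle.dart C k) Fin.≟ u

  module _ (D : Curve G) where

    side-σ : ∀ {x} → ¬ EdgeIn G (cycle D) x → side D (σ x) ≡ side D x
    side-σ {x} off = trans (cong (side D) (sym (φ-σ G x))) (trans (turn D (α x)) (stay D off))

    -- No edge at a vertex off the cycle belongs to the cycle, so rotating about that vertex never
    -- changes the colour.
    side-rotate : ∀ {u} → ¬ VertexIn G (cycle D) u → ∀ {x y} → tail x ≡ u → tail y ≡ u → side D x ≡ side D y
    side-rotate {u} off {x} {y} ex ey with tail-orbit x y (trans ex (sym ey))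
    ... | k , e = trans (sym (go k)) (cong (side D) e)
      where
      go : ∀ k → side D (iter k σ x) ≡ side D x
      go zero    = refl
      go (suc k) = trans (side-σ λ i → off (subst (VertexIn G (cycle D)) (trans (tail-iter G k x) ex) (edge⇒vertex (cycle D) i))) (go k)

    stay-tail : ∀ {x} → ¬ VertexIn G (cycle D) (tail x) → side D (α x) ≡ side D x
    stay-tail off = stay D (off ∘ edge⇒vertex (cycle D))

    stay-head : ∀ {x} → ¬ VertexIn G (cycle D) (tail (α x)) → side D (α x) ≡ side D x
    stay-head off = stay D (off ∘ edge⇒vertex (cycle D) ∘ edgeIn-α G (cycle D))

    complement : Curve G
    complement = record
      { cycle = cycle D
      ; sides = record
        { side = not ∘ side D
        ; turn = cong not ∘ turn D
        ; flip = cong not ∘ flip D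
        ; stay = cong not ∘ stay D
        } }

    module _ (v : Fin n) (C : Cycle G)
      (off : ∀ k → tail (Cycle.dart C k) ≢ v → ¬ VertexIn G (cycle D) (tail (Cycle.dart C k))) where
      open Cycle C

      same-side-from : ∀ b → (∀ l → tail (dart l) ≡ v → l ≡ b) → ∀ k → side D (dart b) ≡ side D (dart k)
      same-side-from b only = around C (λ k → side D (dart b) ≡ side D (dart k)) step b refl
        where
        step : ∀ k l → tail (α (dart k)) ≡ tail (dart l) → side D (dart b) ≡ side D (dart k) → side D (dart b) ≡ side D (dart l)
        step k l e p with tail (dart l) Fin.≟ v
        -- Arriving at `v` means being back at the start `b`, so the colour is never carried through
        -- `v`.
        ... | yes l≡v = cong (side D ∘ dart) (sym (only l l≡v))
        ... | no l≢v = trans p (trans (sym (stay-head (off l l≢v ∘ subst (VertexIn G (cycle D)) e)))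
                         (side-rotate (off l l≢v) e refl))

      -- C minus the single vertex v is connected, so it lies on one side of D.
      same-side : ∀ k k' → side D (dart k) ≡ side D (dart k')
      same-side k k' with vertexIn? C v
      ... | no v∉        = same-side-from k (λ l e → ⊥-elim (v∉ (l , e))) k'
      ... | yes (b , eb) = trans (sym (same-side-from b only k)) (same-side-from b only k')
        where
        only : ∀ l → tail (dart l) ≡ v → l ≡ b
        only l e = distinctV (trans e (sym eb))

  -- Breadth-first levels of `G - v` from `r`. The depth of `v` itself carries no meaning, so every
  -- law keeps away from `v`.
  record Levels (v r : Fin n) : Set where
    field
      depth       : Fin n → ℕ
      root≢       : r ≢ v
      depth-root  : depth r ≡ 0
      root-unique : ∀ {u} → u ≢ v → depth u ≡ 0 → u ≡ r
      lipschitz   : ∀ x → tail x ≢ v → tail (α x) ≢ v → depth (tail (α x)) ≤ suc (depth (tail x))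
      parent      : ∀ u → u ≢ v → 0 < depth u →
        ∃ λ x → tail x ≡ u × tail (α x) ≢ v × suc (depth (tail (α x))) ≡ depth u

  module _ {v r : Fin n} (r≢v : r ≢ v) where
    private
      Within : ℕ → Fin n → Set
      Within zero    u = u ≡ r
      Within (suc i) u = Within i u ⊎ (u ≢ v × ∃ λ x → tail x ≡ u × Within i (tail (α x)))

      within? : ∀ i → Decidable (Within i)
      within? zero    u = u Fin.≟ r
      within? (suc i) u = within? i u ⊎-dec
        (¬? (u Fin.≟ v) ×-dec Fin.any? λ x → (tail x Fin.≟ u) ×-dec within? i (tail (α x)))

      within-≢ : ∀ i {u} → Within i u → u ≢ v
      within-≢ zero    refl = r≢v
      within-≢ (suc i) (inj₁ w) = within-≢ i w
      within-≢ (suc i) (inj₂ (u≢v , _)) = u≢v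

      Linked : Fin n → Set
      Linked u = ∃ λ i → Within i u

      link : ∀ x → tail (α x) ≢ v → Linked (tail x) → Linked (tail (α x))
      link x ne (i , w) = suc i , inj₂ (ne , α x , refl , subst (Within i ∘ tail) (sym (α-invol x)) w)

      -- A path through v is rerouted along the triangles around v.
      linked : ∀ u → u ≢ v → Linked u
      linked u u≢v with tail-surj r | tail-surj u
      ... | b , refl | y , refl = proj₁ (go (connected b y)) u≢v
        where
        -- The invariant survives a visit to `v`: while the current dart starts at `v`, its head is
        -- tracked in place of its tail.
        go : ∀ {y} → Conn α σ b y → (tail y ≢ v → Linked (tail y)) × (tail y ≡ v → Linked (tail (α y)))
        go here = (λ _ → 0 , refl) , λ e → ⊥-elim (r≢v e)
        go (stepα {y} c) = to , λ e → subst (Linked ∘ tail) (sym (α-invol y))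
            (proj₁ (go c) λ e' → no-loop G y (trans e' (sym e)))
          where
          to : tail (α y) ≢ v → Linked (tail (α y))
          to ne with tail y Fin.≟ v
          ... | yes e = proj₂ (go c) e
          ... | no ne' = link y ne (proj₁ (go c) ne')
        go (stepσ {y} c) = (λ ne → subst Linked (sym (tail-σ y)) (proj₁ (go c) (ne ∘ trans (tail-σ y))))
          , λ e → subst Linked (trans (cong tail (α-invol w)) (tail-σ _))
              (link (α w) (λ e' → no-loop G (σ y) (trans e (sym (trans (sym (trans (cong tail (α-invol w)) (tail-σ _))) e'))))
                (subst Linked (sym head-w) (proj₂ (go c) (trans (sym (tail-σ y)) e))))
          where
          -- The darts `α y`, `σ y` and `w` bound one triangle, so `w` joins the heads of `σ y` and
          -- `y` and avoids `v`.
          w = σ (α (σ y))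
          head-w : tail (α w) ≡ tail (α y)
          head-w = trans (cong (λ t → tail (α (σ (α t)))) (sym (φ-σ G y))) (third-head (α y))

      minimal : ∀ u → u ≢ v → ∃ λ l → Within l u × (∀ {k} → k < l → ¬ Within k u)
      minimal u u≢v = least (λ i → within? i u) (proj₂ (linked u u≢v))

      dep : Fin n → ℕ
      dep u with u Fin.≟ v
      ... | yes _ = 0
      ... | no u≢v = proj₁ (minimal u u≢v)

      dep-within : ∀ u → u ≢ v → Within (dep u) u
      dep-within u u≢v with u Fin.≟ v
      ... | yes e = ⊥-elim (u≢v e)
      ... | no ne = proj₁ (proj₂ (minimal u ne))

      dep-≤ : ∀ u i → Within i u → dep u ≤ i
      dep-≤ u i w with u Fin.≟ v
      ... | yes _ = z≤n
      ... | no ne = ℕ.≮⇒≥ λ i<l → proj₂ (proj₂ (minimal u ne)) i<l w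

      lip : ∀ x → tail x ≢ v → tail (α x) ≢ v → dep (tail (α x)) ≤ suc (dep (tail x))
      lip x ne ne' = dep-≤ _ _ (inj₂ (ne' , α x , refl ,
        subst (Within (dep (tail x)) ∘ tail) (sym (α-invol x)) (dep-within (tail x) ne)))

      par : ∀ u l → dep u ≡ l → u ≢ v → 0 < l → ∃ λ x → tail x ≡ u × tail (α x) ≢ v × suc (dep (tail (α x))) ≡ l
      par u (suc m) e u≢v _ with subst (λ l → Within l u) e (dep-within u u≢v)
      ... | inj₁ w = ⊥-elim (ℕ.<-irrefl refl (ℕ.≤-trans (ℕ.≤-reflexive (sym e)) (dep-≤ u m w)))
      ... | inj₂ (_ , x , refl , w) = x , refl , ne , ℕ.≤-antisym (s≤s (dep-≤ _ m w))
          (ℕ.≤-trans (ℕ.≤-reflexive (trans (sym e) (cong (dep ∘ tail) (sym (α-invol x)))))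
            (lip (α x) ne (u≢v ∘ trans (cong tail (sym (α-invol x))))))
        where
        ne = within-≢ m w

    abstract
      levels : Levels v r
      levels = record
        { depth = dep
        ; root≢ = r≢v
        ; depth-root = ℕ.n≤0⇒n≡0 (dep-≤ r 0 refl)
        ; root-unique = λ {u} u≢v e → subst (λ l → Within l u) e (dep-within u u≢v)
        ; lipschitz = lip
        ; parent = λ u → par u (dep u) refl
        }

-- Separating cycles in the distance layers

does⇒ : ∀ {A : Set} (a? : Dec A) → does a? ≡ true → A
does⇒ (yes a) _ = a

does⇒¬ : ∀ {A : Set} (a? : Dec A) → does a? ≡ false → ¬ A
does⇒¬ (no ¬a) _ = ¬a

∧-true : ∀ a {b} → a ∧ b ≡ true → a ≡ true × b ≡ true
∧-true true e = refl , e

module _ {n d : ℕ} (G : PlaneTriangulation n d) where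
  open PlaneTriangulation G
  open Curve

  module Layering {v r : Fin n} (L : Levels G v r) (z : Fin d) (z≢v : tail z ≢ v) (o : Fin d) (o≡r : tail o ≡ r) where
    open Levels L

    Low : ℕ → Fin n → Set
    Low i u = u ≡ v ⊎ depth u ≤ i

    low? : ∀ i → Decidable (Low i)
    low? i u = (u Fin.≟ v) ⊎-dec (depth u ℕ.≤? i)

    low : ℕ → Fin n → Bool
    low i u = does (low? i u)

    -- A set of triangles, not of vertices: its boundary consists of edges, from which
    -- `separating-cycle` can extract a cycle.
    ball : ℕ → Fin d → Bool
    ball i x = low i (tail x) ∧ (low i (tail (σ (α x))) ∧ low i (tail (σ (α (σ (α x))))))

    ball-turn : ∀ i x → ball i (σ (α x)) ≡ ball i x
    ball-turn i x = trans (cong (λ y → p₁ ∧ (p₂ ∧ low i (tail y))) (face-tri x))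
        (trans (cong (p₁ ∧_) (Bool.∧-comm p₂ p₀)) (trans (sym (Bool.∧-assoc p₁ p₀ p₂))
          (trans (cong (_∧ p₂) (Bool.∧-comm p₁ p₀)) (Bool.∧-assoc p₀ p₁ p₂))))
      where
      p₀ = low i (tail x)
      p₁ = low i (tail (σ (α x)))
      p₂ = low i (tail (σ (α (σ (α x)))))

    OnLayer : ℕ → Fin n → Set
    OnLayer i u = u ≡ v ⊎ depth u ≡ i

    squeeze : ∀ {i u q} → Low i u → (u ≢ v → depth q ≤ suc (depth u)) → i < depth q → OnLayer i u
    squeeze {u = u} l h i<q with u Fin.≟ v | l
    ... | yes e | _ = inj₁ e
    ... | no ne | inj₁ e = inj₁ e
    ... | no ne | inj₂ le = inj₂ (ℕ.≤-antisym le (ℕ.≤-pred (ℕ.≤-trans i<q (h ne))))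

    -- Both ends of `y` are corners of a triangle in the ball, so the third corner of the triangle
    -- across `y` must be the high one. An end other than `v` is low and adjacent to a vertex of
    -- depth above `i`, hence has depth exactly `i`.
    ball-boundary : ∀ i y → ball i y ≡ true → ball i (α y) ≡ false → OnLayer i (tail y) × OnLayer i (tail (α y))
    ball-boundary i y t f =
        squeeze (does⇒ (low? i (tail y)) low-y) (λ ne → subst₂ (λ p q → depth p ≤ suc (depth q)) (sym (tail-σ (α σy))) tail-σy
          (lipschitz σy (ne ∘ trans (sym tail-σy)) λ e → q-high (inj₁ (trans (tail-σ (α σy)) e)))) i<q
      , squeeze (does⇒ (low? i (tail (α y))) low-αy) (λ ne → subst₂ (λ p q → depth p ≤ suc (depth q)) αα (third-head G (α y))
          (lipschitz (α w) (ne ∘ trans (sym (third-head G (α y)))) λ e → q-high (inj₁ (trans (sym αα) e)))) i<q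
      where
      -- σy and w are the other two darts of the face of α y.
      σy = σ (α (α y))
      w  = σ (α σy)
      tail-σy : tail σy ≡ tail y
      tail-σy = trans (tail-σ _) (cong tail (α-invol y))
      αα : tail (α (α w)) ≡ tail w
      αα = cong tail (α-invol w)
      low-y : low i (tail y) ≡ true
      low-y = proj₁ (∧-true (low i (tail y)) t)
      low-αy : low i (tail (α y)) ≡ true
      low-αy = trans (cong (low i) (sym (tail-σ (α y))))
        (proj₁ (∧-true (low i (tail (σ (α y)))) (proj₂ (∧-true (low i (tail y)) t))))
      q-high : ¬ Low i (tail w)
      q-high = does⇒¬ (low? i (tail w))
        (trans (sym (cong₂ (λ a b → a ∧ (b ∧ low i (tail w))) low-αy (trans (cong (low i) tail-σy) low-y))) f)
      i<q : i < depth (tail w)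
      i<q = ℕ.≰⇒> (q-high ∘ inj₂)

    ball-layer : ∀ i {e} → ball i e ≢ ball i (α e) → OnLayer i (tail e)
    ball-layer i {e} ne with ball i e in e₁ | ball i (α e) in e₂
    ... | true  | true  = ⊥-elim (ne refl)
    ... | true  | false = proj₁ (ball-boundary i e e₁ e₂)
    ... | false | true  = subst (OnLayer i ∘ tail) (α-invol e)
            (proj₂ (ball-boundary i (α e) e₂ (trans (cong (ball i) (α-invol e)) e₁)))
    ... | false | false = ⊥-elim (ne refl)

    -- The other two corners of a triangle at the root have depth at most 1 or equal `v`; this is
    -- where `1 ≤ i` enters.
    ball-root : ∀ i → 1 ≤ i → ball i o ≡ true
    ball-root i 1≤i = cong₂ _∧_ (near (inj₁ o≡r))
        (cong₂ _∧_ (near (inj₂ (o , o≡r , sym (tail-σ (α o)))))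
                   (near (inj₂ (α w , trans (third-head G o) o≡r , cong tail (α-invol w)))))
      where
      w = σ (α (σ (α o)))
      near : ∀ {u} → u ≡ r ⊎ (∃ λ x → tail x ≡ r × tail (α x) ≡ u) → low i u ≡ true
      near {u} (inj₁ refl) = dec-true (low? i u) (inj₂ (ℕ.≤-trans (ℕ.≤-reflexive depth-root) z≤n))
      near {u} (inj₂ (x , e , refl)) = dec-true (low? i u) (bound (u Fin.≟ v))
        where
        bound : Dec (u ≡ v) → Low i u
        bound (yes p) = inj₁ p
        bound (no ne) = inj₂ (ℕ.≤-trans (lipschitz x (root≢ ∘ trans (sym e)) ne)
          (ℕ.≤-trans (ℕ.≤-reflexive (cong suc (trans (cong depth e) depth-root))) 1≤i))

    ball-far : ∀ i → i < depth (tail z) → ball i z ≡ false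
    ball-far i i<z = cong (_∧ (low i (tail (σ (α z))) ∧ low i (tail (σ (α (σ (α z))))))) (dec-false (low? i (tail z)) λ where
      (inj₁ e) → z≢v e
      (inj₂ le) → ℕ.<⇒≱ i<z le)

    record LayerCurve (i : ℕ) : Set where
      field
        curve   : Curve G
        on-edge : ∀ {e} → EdgeIn G (cycle curve) e → OnLayer i (tail e)
        at-root : side curve o ≡ false
        at-far  : side curve z ≡ true

    open LayerCurve

    layerCurve : ∀ i → 1 ≤ i → i < depth (tail z) → LayerCurve i
    layerCurve i 1≤i i<z with separating-cycle G (ball i) (ball-turn i) o z
      (λ e → Bool.not-¬ refl (trans (sym (ball-far i i<z)) (trans (sym e) (ball-root i 1≤i))))
    ... | C , S , sep , within with Side.side S o in eo | Side.side S z in ez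
    ...   | true  | true  = ⊥-elim (sep refl)
    ...   | true  | false = record { curve = complement G (record { cycle = C ; sides = S })
                                   ; on-edge = ball-layer i ∘ within ; at-root = cong not eo ; at-far = cong not ez }
    ...   | false | true  = record { curve = record { cycle = C ; sides = S }
                                   ; on-edge = ball-layer i ∘ within ; at-root = eo ; at-far = ez }
    ...   | false | false = ⊥-elim (sep refl)

    on-vertex : ∀ {i} (Λ : LayerCurve i) {u} → VertexIn G (cycle (curve Λ)) u → OnLayer i u
    on-vertex Λ (k , refl) = on-edge Λ (k , inj₁ refl)

    off-layer : ∀ {i} (Λ : LayerCurve i) {u} → u ≢ v → depth u ≢ i → ¬ VertexIn G (cycle (curve Λ)) u
    off-layer Λ u≢v ne on with on-vertex Λ on
    ... | inj₁ e = u≢v e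
    ... | inj₂ e = ne e

    -- Following parents from depth `l < j` down to the root never meets layer `j` or `v`, so the
    -- colour at the root persists.
    below : ∀ {j} (Λ : LayerCurve j) l y → tail y ≢ v → depth (tail y) ≡ l → l < j → side (curve Λ) y ≡ false
    below Λ zero y y≢v e l<j = trans (side-rotate G (curve Λ) (off-layer Λ y≢v λ e' → ℕ.<-irrefl (trans (sym e) e') l<j)
      refl (trans o≡r (sym (root-unique y≢v e)))) (at-root Λ)
    below Λ (suc l) y y≢v e l<j with parent (tail y) y≢v (ℕ.≤-trans (s≤s z≤n) (ℕ.≤-reflexive (sym e)))
    ... | x , tx , ne , dx = trans (side-rotate G (curve Λ) off refl tx)
        (trans (sym (stay-tail G (curve Λ) (off ∘ subst (VertexIn G (cycle (curve Λ))) tx)))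
          (below Λ l (α x) ne (ℕ.suc-injective (trans dx e)) (ℕ.<-trans (ℕ.n<1+n l) l<j)))
      where
      off : ¬ VertexIn G (cycle (curve Λ)) (tail y)
      off = off-layer Λ y≢v λ e' → ℕ.<-irrefl (trans (sym e) e') l<j

    -- Descending from z, the first layer-j vertex met lies on the layer-j curve,
    -- and the layer-i curve has not been crossed yet.
    descend : ∀ {i j} (Λ : LayerCurve i) (Λ' : LayerCurve j) → i < j → ∀ m y → tail y ≢ v → depth (tail y) ≡ m + j →
      side (curve Λ) y ≡ true → side (curve Λ') y ≡ true →
      ∃ λ x → tail x ≢ v × VertexIn G (cycle (curve Λ')) (tail x) × side (curve Λ) x ≡ true
    descend {i} {j} Λ Λ' i<j m y y≢v e s s' with parent (tail y) y≢v
      (ℕ.≤-trans (ℕ.≤-trans (s≤s z≤n) i<j) (ℕ.≤-trans (ℕ.m≤n+m j m) (ℕ.≤-reflexive (sym e))))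
    ... | x , tx , ne , dx = go m e
      where
      rotate : ∀ {l} (Λ : LayerCurve l) → ¬ VertexIn G (cycle (curve Λ)) (tail y) → side (curve Λ) y ≡ true → side (curve Λ) (α x) ≡ true
      rotate Λ off s = trans (stay-tail G (curve Λ) (off ∘ subst (VertexIn G (cycle (curve Λ))) tx))
        (trans (side-rotate G (curve Λ) off tx refl) s)
      go : ∀ m → depth (tail y) ≡ m + j → ∃ λ x → tail x ≢ v × VertexIn G (cycle (curve Λ')) (tail x) × side (curve Λ) x ≡ true
      go zero e with vertexIn? G (cycle (curve Λ')) (tail y)
      ... | yes on = y , y≢v , on , s
      ... | no off with () ← trans (sym (rotate Λ' off s'))
                 (below Λ' (depth (tail (α x))) (α x) ne refl (ℕ.≤-reflexive (trans dx e)))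
      go (suc m) e = descend Λ Λ' i<j m (α x) ne (ℕ.suc-injective (trans dx e))
          (rotate Λ (off-layer Λ y≢v (above i (ℕ.≤-trans (ℕ.<⇒≤ i<j) (ℕ.m≤n+m j m)))) s)
          (rotate Λ' (off-layer Λ' y≢v (above j (ℕ.m≤n+m j m))) s')
        where
        above : ∀ l → l ≤ m + j → depth (tail y) ≢ l
        above l le e' = ℕ.<-irrefl (trans (sym e') e) (s≤s le)

    -- Weaker than `Precedes` in that `v` may or may not be shared; the final split into curves
    -- through `v` and curves avoiding it decides this.
    record LayerPrecedes (D D' : Curve G) : Set where
      field
        inner  : ∀ {y} → EdgeIn G (cycle D') y → side D y ≡ true
        outer  : ∀ {y} → EdgeIn G (cycle D) y → side D' y ≡ false
        common : ∀ {u} → VertexIn G (cycle D) u → VertexIn G (cycle D') u → u ≡ v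

    layers-disjoint : ∀ {i j} (Λ : LayerCurve i) (Λ' : LayerCurve j) → i ≢ j →
      ∀ {u} → VertexIn G (cycle (curve Λ)) u → VertexIn G (cycle (curve Λ')) u → u ≡ v
    layers-disjoint Λ Λ' i≢j on on' with on-vertex Λ on | on-vertex Λ' on'
    ... | inj₁ e | _ = e
    ... | inj₂ _ | inj₁ e = e
    ... | inj₂ e | inj₂ e' = ⊥-elim (i≢j (trans (sym e) e'))

    -- For `outer`, every edge of the inner-layer curve has an end of depth `i`, to which `below`
    -- applies. For `inner`, `descend` finds one vertex of the other curve on the far side, and
    -- `same-side` spreads its colour over that curve.
    layer-precedes : ∀ {i j} (Λ : LayerCurve i) (Λ' : LayerCurve j) → i < j → j < depth (tail z) →
      LayerPrecedes (curve Λ) (curve Λ')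
    layer-precedes {i} {j} Λ Λ' i<j j<z = record
      { inner = inner ; outer = outer ; common = layers-disjoint Λ Λ' (ℕ.<⇒≢ i<j) }
      where
      C' = cycle (curve Λ')
      off' : ∀ {u} → u ≢ v → VertexIn G (cycle (curve Λ)) u → ¬ VertexIn G C' u
      off' u≢v on on' = u≢v (layers-disjoint Λ Λ' (ℕ.<⇒≢ i<j) on on')
      off : ∀ {u} → u ≢ v → VertexIn G C' u → ¬ VertexIn G (cycle (curve Λ)) u
      off u≢v on' on = u≢v (layers-disjoint Λ Λ' (ℕ.<⇒≢ i<j) on on')
      v-free : ∀ x → tail x ≡ v → tail (α x) ≢ v
      v-free x e e' = no-loop G x (trans e (sym e'))

      outer : ∀ {y} → EdgeIn G (cycle (curve Λ)) y → side (curve Λ') y ≡ false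
      outer {y} on with on-edge Λ on | tail y Fin.≟ v
      ... | inj₂ e | no y≢v = below Λ' i y y≢v e i<j
      ... | inj₁ e | no y≢v = ⊥-elim (y≢v e)
      ... | _      | yes e with on-edge Λ (edgeIn-α G (cycle (curve Λ)) on)
      ...   | inj₁ e' = ⊥-elim (v-free y e e')
      ...   | inj₂ e' = trans (sym (stay-head G (curve Λ') (off' (v-free y e) (edge⇒vertex G (cycle (curve Λ)) (edgeIn-α G (cycle (curve Λ)) on)))))
                          (below Λ' i (α y) (v-free y e) e' i<j)

      sample : ∃ λ x → tail x ≢ v × VertexIn G C' (tail x) × side (curve Λ) x ≡ true
      sample = descend Λ Λ' i<j (depth (tail z) ∸ j) z z≢v (sym (ℕ.m∸n+n≡m (ℕ.<⇒≤ j<z))) (at-far Λ) (at-far Λ')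

      darts : ∀ k → side (curve Λ) (Cycle.dart C' k) ≡ true
      darts k with sample
      ... | x , x≢v , (b , eb) , s = trans (same-side G (curve Λ) v C' (λ k ne → off ne (k , refl)) k b)
              (trans (side-rotate G (curve Λ) (off x≢v (b , eb)) eb refl) s)

      inner : ∀ {y} → EdgeIn G C' y → side (curve Λ) y ≡ true
      inner (k , inj₁ refl) = darts k
      inner (k , inj₂ refl) with tail (Cycle.dart C' k) Fin.≟ v
      ... | no ne = trans (stay-tail G (curve Λ) (off ne (k , refl))) (darts k)
      ... | yes e = trans (stay-head G (curve Λ) (off (v-free _ e) (edge⇒vertex G C' (k , inj₂ refl)))) (darts k)

  -- The `4k` layers are halved twice: by whether the curve passes through `v`, which fixes the
  -- common set as `v` alone or empty, and by the side of the outer face inside `family⇒nest`.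
  deep⇒nest : ∀ {v r} (L : Levels G v r) o k u → u ≢ v → (k + k) + (k + k) < Levels.depth L u →
    ∃ λ s → s ≤ 2 × HasNest G o s k
  deep⇒nest {v} {r} L o k u u≢v deep = result (majority through? (k + k) Ds (ℕ.≤-reflexive (sym (length-tabulate D))))
    where
    open Levels L
    z = proj₁ (tail-surj u)
    b = proj₁ (tail-surj r)
    module Lay = Layering L z (u≢v ∘ trans (sym (proj₂ (tail-surj u)))) b (proj₂ (tail-surj r))
    m = (k + k) + (k + k)
    bound : ∀ (i : Fin m) → suc (toℕ i) < depth (tail z)
    bound i = ℕ.<-≤-trans (s≤s (Fin.toℕ<n i)) (ℕ.≤-trans deep (ℕ.≤-reflexive (cong depth (sym (proj₂ (tail-surj u))))))
    -- Layers are counted from 1, the first index allowed by `ball-root`.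
    Λ : ∀ (i : Fin m) → Lay.LayerCurve (suc (toℕ i))
    Λ i = Lay.layerCurve (suc (toℕ i)) (s≤s z≤n) (bound i)
    D : Fin m → Curve G
    D i = Lay.LayerCurve.curve (Λ i)
    Ds : List (Curve G)
    Ds = tabulate D
    pairs : AllPairs Lay.LayerPrecedes Ds
    pairs = AllPairs.tabulate⁺-< λ {i} {j} i<j → Lay.layer-precedes (Λ i) (Λ j) (s≤s i<j) (bound j)
    through? : Decidable (λ D → VertexIn G (cycle D) v)
    through? D = vertexIn? G (cycle D) v
    result : k + k ≤ length (filter through? Ds) ⊎ k + k ≤ length (filter (∁? through?) Ds) →
      ∃ λ s → s ≤ 2 × HasNest G o s k
    result (inj₁ long) = ∣ ⁅ v ⁆ ∣ , ℕ.≤-trans (ℕ.≤-reflexive (Subset.∣⁅x⁆∣≡1 v)) (s≤s z≤n) ,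
      family⇒nest G o ⁅ v ⁆ k (filter through? Ds)
        (allPairs-with (λ {D} {D'} on on' p → let open Lay.LayerPrecedes p in record { inner = inner ; outer = outer ; common = λ u →
            mk⇔ (λ (a , b) → subst (_∈ₛ ⁅ v ⁆) (sym (common a b)) (Subset.x∈⁅x⁆ v))
                (λ u∈ → subst (λ u → VertexIn G (cycle D) u × VertexIn G (cycle D') u) (sym (Subset.x∈⁅y⁆⇒x≡y v u∈)) (on , on')) })
          (all-filter through? Ds) (AllPairs.filter⁺ through? pairs)) long
    result (inj₂ long) = ∣ ⊥ {n} ∣ , ℕ.≤-trans (ℕ.≤-reflexive (Subset.∣⊥∣≡0 n)) z≤n ,
      family⇒nest G o ⊥ k (filter (∁? through?) Ds)
        (allPairs-with (λ {D} off off' p → let open Lay.LayerPrecedes p in record { inner = inner ; outer = outer ; common = λ u →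
            mk⇔ (λ (a , b) → ⊥-elim (off (subst (VertexIn G (cycle D)) (common a b) a)))
                (λ u∈ → ⊥-elim (Subset.∉⊥ u∈)) })
          (all-filter (∁? through?) Ds) (AllPairs.filter⁺ (∁? through?) pairs)) long

-- Branching in trees

AllPairs-resp-⊆ : ∀ {A : Set} {R : A → A → Set} {xs ys} → xs ⊆ ys → AllPairs R ys → AllPairs R xs
AllPairs-resp-⊆ []        []       = []
AllPairs-resp-⊆ (_ ∷ʳ s)  (_ ∷ rs) = AllPairs-resp-⊆ s rs
AllPairs-resp-⊆ (refl ∷ s) (r ∷ rs) = All-resp-⊆ s r ∷ AllPairs-resp-⊆ s rs

AllPairs-resp-↭ : ∀ {A : Set} {R : A → A → Set} → (∀ {x y} → R x y → R y x) →
  ∀ {xs ys} → xs ↭ ys → AllPairs R xs → AllPairs R ys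
AllPairs-resp-↭ s ↭.refl         rs = rs
AllPairs-resp-↭ s (↭.prep _ p)   (r ∷ rs) = All-resp-↭ p r ∷ AllPairs-resp-↭ s p rs
AllPairs-resp-↭ s (↭.swap _ _ p) ((q ∷ r) ∷ r' ∷ rs) =
  (s q ∷ All-resp-↭ p r') ∷ All-resp-↭ p r ∷ AllPairs-resp-↭ s p rs
AllPairs-resp-↭ s (↭.trans p q)  rs = AllPairs-resp-↭ s q (AllPairs-resp-↭ s p rs)

module _ {A : Set} (f : A → ℕ) where

  private
    _≺_ _≉_ : A → A → Set
    x ≺ y = f x < f y
    x ≉ y = f x ≢ f y

  insert-sorted : ∀ x {xs} → AllPairs _≺_ xs → All (x ≉_) xs → ∃ λ ys → ys ↭ x ∷ xs × AllPairs _≺_ ys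
  insert-sorted x [] [] = x ∷ [] , ↭-refl , [] ∷ []
  insert-sorted x {y ∷ xs} (r ∷ rs) (ne ∷ nes) with ℕ.<-cmp (f x) (f y)
  ... | tri< lt _ _ = x ∷ y ∷ xs , ↭-refl , (lt ∷ All.map (ℕ.<-trans lt) r) ∷ r ∷ rs
  ... | tri≈ _ eq _ = ⊥-elim (ne eq)
  ... | tri> _ _ gt with insert-sorted x rs nes
  ...   | ys , p , s = y ∷ ys , ↭-trans (↭.prep y p) (↭.swap y x ↭-refl) , All-resp-↭ (↭-sym p) (gt ∷ r) ∷ s

  strictly-sorted : ∀ {xs} → AllPairs _≉_ xs → ∃ λ ys → ys ↭ xs × AllPairs _≺_ ys
  strictly-sorted [] = [] , ↭-refl , []
  strictly-sorted {x ∷ xs} (ne ∷ nes) with strictly-sorted nes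
  ... | ys , p , s with insert-sorted x s (All-resp-↭ (↭-sym p) ne)
  ...   | zs , q , t = zs , ↭-trans q (↭.prep x p) , t

-- More than `need m D` distinct points whose `D`-th iterates under a parent map agree force `m`
-- distinct children of one vertex. The value 1 at depth 0 says that two distinct points cannot
-- agree; the factor `suc m` keeps the function monotone in the depth even for `m = 0`.
need : ℕ → ℕ → ℕ
need m zero    = 1
need m (suc D) = suc m * suc (need m D)

need-mono : ∀ m {D K} → D ≤ K → need m D ≤ need m K
need-mono m {zero}  {zero}  _ = ℕ.≤-refl
need-mono m {zero}  {suc K} _ = s≤s z≤n
need-mono m {suc D} {suc K} (s≤s le) = ℕ.*-monoʳ-≤ (suc m) (s≤s (need-mono m le))

-- There are `suc K` possible depths; this many points leave more than `need m K` of them at one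
-- depth.
required : ℕ → ℕ → ℕ
required m K = suc K * suc (suc (need m K))

module _ {A : Set} where

  common-value : (f : A → ℕ) → ∀ K b xs → All (λ x → f x ≤ K) xs → suc K * suc b ≤ length xs →
    ∃ λ D → D ≤ K × ∃ λ ys → ys ⊆ xs × suc b ≤ length ys × All (λ y → f y ≡ D) ys
  common-value f zero b xs le long = 0 , z≤n , xs , ⊆-refl , ℕ.≤-trans (ℕ.≤-reflexive (sym (ℕ.+-identityʳ (suc b)))) long , All.map ℕ.n≤0⇒n≡0 le
  common-value f (suc K) b xs le long with suc b ℕ.≤? length (filter (λ x → f x ℕ.≟ suc K) xs)
  ... | yes many = suc K , ℕ.≤-refl , _ , filter-⊆ _ xs , many , all-filter _ xs
  ... | no few with common-value f K b (filter (∁? P?) xs)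
            (All.zipWith (λ (ne , le) → ℕ.≤-pred (ℕ.≤∧≢⇒< le ne)) (all-filter (∁? P?) xs , All-resp-⊆ (filter-⊆ (∁? P?) xs) le))
            (ℕ.+-cancelˡ-≤ (suc b) _ _ (ℕ.≤-trans long (ℕ.≤-trans (ℕ.≤-reflexive (sym (length-split P? xs)))
              (ℕ.+-monoˡ-≤ _ (ℕ.<⇒≤ (ℕ.≰⇒> few))))))
    where
    P? : Decidable (λ x → f x ≡ suc K)
    P? x = f x ℕ.≟ suc K
  ...   | D , D≤K , ys , s , l , all = D , ℕ.m≤n⇒m≤1+n D≤K , ys , ⊆-trans s (filter-⊆ _ xs) , l , all

  module _ {B : Set} (_≟_ : DecidableEquality B) where

    -- Greedy pigeonhole: either the class of the first element has more than `b` members, or it is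
    -- deleted at a cost of at most `b` and the first element kept as a representative, up to `a`
    -- times.
    distinct-or-common : (f : A → B) → ∀ a b xs → a * suc b ≤ length xs →
      (∃ λ ys → ys ⊆ xs × a ≤ length ys × AllPairs (λ x y → f x ≢ f y) ys) ⊎
      (∃ λ c → ∃ λ ys → ys ⊆ xs × suc b ≤ length ys × All (λ y → f y ≡ c) ys)
    distinct-or-common f zero b xs _ = inj₁ ([] , minimum xs , z≤n , [])
      where
      minimum : ∀ xs → [] ⊆ xs
      minimum [] = []
      minimum (x ∷ xs) = x ∷ʳ minimum xs
    distinct-or-common f (suc a) b (x ∷ xs) long with suc b ℕ.≤? length (filter (λ y → f y ≟ f x) (x ∷ xs))
    ... | yes many = inj₂ (f x , filter (λ y → f y ≟ f x) (x ∷ xs) , filter-⊆ (λ y → f y ≟ f x) (x ∷ xs) , many , all-filter (λ y → f y ≟ f x) (x ∷ xs))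
    ... | no few with distinct-or-common f a b (filter (∁? P?) xs) rest
      where
      P? : Decidable (λ y → f y ≡ f x)
      P? y = f y ≟ f x
      rest : a * suc b ≤ length (filter (∁? P?) xs)
      rest = subst (λ zs → a * suc b ≤ length zs) (filter-reject (∁? P?) {x} {xs} (λ ne → ne refl))
        (ℕ.+-cancelˡ-≤ (suc b) _ _ (ℕ.≤-trans long (ℕ.≤-trans (ℕ.≤-reflexive (sym (length-split P? (x ∷ xs))))
          (ℕ.+-monoˡ-≤ _ (ℕ.<⇒≤ (ℕ.≰⇒> few))))))
    ...   | inj₁ (ys , s , l , ap) = inj₁ (x ∷ ys , refl ∷ ⊆-trans s (filter-⊆ _ xs) , s≤s l ,
              All.map (λ ne e → ne (sym e)) (All-resp-⊆ s (all-filter _ xs)) ∷ ap)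
    ...   | inj₂ (c , ys , s , l , all) = inj₂ (c , ys , x ∷ʳ ⊆-trans s (filter-⊆ _ xs) , l , all)

    -- Look one step before the common image `c`. Either `m` of the iterates there are distinct, and
    -- they are children of `c`, or many points already share a value there and the recursion
    -- continues with that value.
    branching : (par : B → B) (h : A → B) → ∀ m D c xs → need m D < length xs →
      AllPairs (λ x y → h x ≢ h y) xs → All (λ x → iter D par (h x) ≡ c) xs →
      ∃₂ λ t w → ∃ λ ys → t < D × ys ⊆ xs × m ≤ length ys ×
        All (λ y → par (iter t par (h y)) ≡ w) ys × AllPairs (λ x y → iter t par (h x) ≢ iter t par (h y)) ys
    branching par h m zero c (x ∷ []) (s≤s ()) ap all
    branching par h m zero c (x ∷ y ∷ xs) long ((ne ∷ _) ∷ _) (ex ∷ ey ∷ _) = ⊥-elim (ne (trans ex (sym ey)))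
    branching par h m (suc D) c xs long ap all
      with distinct-or-common (λ x → iter D par (h x)) m (need m D) xs
             (ℕ.≤-trans (ℕ.m≤n+m (m * suc (need m D)) (suc (need m D))) (ℕ.<⇒≤ long))
    ... | inj₁ (ys , s , l , distinct) = D , c , ys , ℕ.n<1+n D , s , l , All-resp-⊆ s all , distinct
    ... | inj₂ (c' , ys , s , l , all') with branching par h m D c' ys l (AllPairs-resp-⊆ s ap) all'
    ...   | t , w , zs , t<D , s' , rest = t , w , zs , ℕ.m<n⇒m<1+n t<D , ⊆-trans s' s , rest

-- Ancestors in the breadth-first tree

module _ {n d : ℕ} (G : PlaneTriangulation n d) where
  open PlaneTriangulation G

  module Tree {v r : Fin n} (L : Levels G v r) where
    open Levels L

    private
      choose : ∀ u → Dec (u ≡ v) → Dec (0 < depth u) → Fin d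
      choose u (no u≢v) (yes pos) = proj₁ (parent u u≢v pos)
      choose u _        _         = proj₁ (tail-surj u)

    -- Junk (an arbitrary dart at u) when u = v or u is the root.
    parentDart : Fin n → Fin d
    parentDart u = choose u (u Fin.≟ v) (0 ℕ.<? depth u)

    par : Fin n → Fin n
    par u = tail (α (parentDart u))

    tail-parentDart : ∀ u → tail (parentDart u) ≡ u
    tail-parentDart u with u Fin.≟ v | 0 ℕ.<? depth u
    ... | no u≢v | yes pos = proj₁ (proj₂ (parent u u≢v pos))
    ... | yes _  | _       = proj₂ (tail-surj u)
    ... | no _   | no _    = proj₂ (tail-surj u)

    par-level : ∀ {u l} → u ≢ v → depth u ≡ suc l → par u ≢ v × depth (par u) ≡ l
    par-level {u} {l} u≢v e with u Fin.≟ v | 0 ℕ.<? depth u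
    ... | yes p | _ = ⊥-elim (u≢v p)
    ... | no _  | no npos = ⊥-elim (npos (subst (0 <_) (sym e) (s≤s z≤n)))
    ... | no ne | yes pos = proj₁ (proj₂ (proj₂ (parent u ne pos))) ,
            ℕ.suc-injective (trans (proj₂ (proj₂ (proj₂ (parent u ne pos)))) e)

    anc : ℕ → Fin n → Fin n
    anc t u = iter t par u

    anc-level : ∀ {u} t {l} → u ≢ v → depth u ≡ t + l → anc t u ≢ v × depth (anc t u) ≡ l
    anc-level zero    u≢v e = u≢v , e
    anc-level (suc t) {l} u≢v e with anc-level t {suc l} u≢v (trans e (sym (ℕ.+-suc t l)))
    ... | ne , e' = par-level ne e'

    anc-root : ∀ {u D} → u ≢ v → depth u ≡ D → anc D u ≡ r
    anc-root {D = D} u≢v e with anc-level D {0} u≢v (trans e (sym (ℕ.+-identityʳ D)))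
    ... | ne , e' = root-unique ne e'

    -- Restricting to one depth synchronises the ancestor paths: all reach the root after the same
    -- number of steps, which is the merging that `branching` starts from.
    branch : ∀ {A : Set} (h : A → Fin n) m K xs → All (λ x → h x ≢ v) xs → All (λ x → depth (h x) ≤ K) xs →
      AllPairs (λ x y → h x ≢ h y) xs → required m K ≤ length xs →
      ∃ λ D → ∃₂ λ t w → ∃ λ ys → t < D × ys ⊆ xs × m ≤ length ys × All (λ y → depth (h y) ≡ D) ys ×
        All (λ y → par (anc t (h y)) ≡ w) ys × AllPairs (λ x y → anc t (h x) ≢ anc t (h y)) ys
    branch h m K xs ≢v le ap long with common-value (depth ∘ h) K (suc (need m K)) xs le long
    ... | D , D≤K , ys , s , l , same
      with branching Fin._≟_ par h m D r ys (ℕ.≤-trans (s≤s (need-mono m D≤K)) (ℕ.<⇒≤ l)) (AllPairs-resp-⊆ s ap)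
             (All.zipWith (λ (ne , e) → anc-root ne e) (All-resp-⊆ s ≢v , same))
    ...   | t , w , zs , t<D , s' , l' , rest =
            D , t , w , zs , t<D , ⊆-trans s' s , l' , All-resp-⊆ s' same , rest

-- Internally disjoint paths between two vertices

∣⁅x⁆∪⁅y⁆∣≡2 : ∀ {n} {x y : Fin n} → x ≢ y → ∣ ⁅ x ⁆ ∪ ⁅ y ⁆ ∣ ≡ 2
∣⁅x⁆∪⁅y⁆∣≡2 {x = zero}  {zero}  ne = ⊥-elim (ne refl)
∣⁅x⁆∪⁅y⁆∣≡2 {x = zero}  {suc y} ne = cong suc (trans (cong ∣_∣ (Subset.∪-identityˡ ⁅ y ⁆)) (Subset.∣⁅x⁆∣≡1 y))
∣⁅x⁆∪⁅y⁆∣≡2 {x = suc x} {zero}  ne = cong suc (trans (cong ∣_∣ (Subset.∪-identityʳ ⁅ x ⁆)) (Subset.∣⁅x⁆∣≡1 x))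
∣⁅x⁆∪⁅y⁆∣≡2 {x = suc x} {suc y} ne = ∣⁅x⁆∪⁅y⁆∣≡2 (ne ∘ cong suc)

iter-+ : ∀ {A : Set} a b (f : A → A) x → iter (a + b) f x ≡ iter a f (iter b f x)
iter-+ zero    b f x = refl
iter-+ (suc a) b f x = cong f (iter-+ a b f x)

module _ {n d : ℕ} (G : PlaneTriangulation n d) where
  open PlaneTriangulation G
  open Curve

  α-injective : ∀ {x y} → α x ≡ α y → x ≡ y
  α-injective e = trans (sym (α-invol _)) (trans (cong α e) (α-invol _))

  -- Colours along the rotation at a vertex of a cycle

  module Rotation {v : Fin n} (b : Fin d) (b≡v : tail b ≡ v) where

    rot : ℕ → Fin d
    rot k = iter k σ b

    private
      position : ∀ x → tail x ≡ v → ∃ λ p → rot p ≡ x × (∀ {k} → k < p → rot k ≢ x)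
      position x e = least (λ k → rot k Fin.≟ x) {proj₁ orbit} (proj₂ orbit)
        where orbit = tail-orbit b x (trans b≡v (sym e))

    -- Junk value 0 for darts that do not start at v.
    pos : Fin d → ℕ
    pos x with tail x Fin.≟ v
    ... | yes e = proj₁ (position x e)
    ... | no _  = 0

    rot-pos : ∀ {x} → tail x ≡ v → rot (pos x) ≡ x
    rot-pos {x} e with tail x Fin.≟ v
    ... | yes e' = proj₁ (proj₂ (position x e'))
    ... | no ne  = ⊥-elim (ne e)

    pos-least : ∀ {x} → tail x ≡ v → ∀ {k} → k < pos x → rot k ≢ x
    pos-least {x} e with tail x Fin.≟ v
    ... | yes e' = proj₂ (proj₂ (position x e'))
    ... | no ne  = ⊥-elim (ne e)

    pos-injective : ∀ {x y} → tail x ≡ v → tail y ≡ v → pos x ≡ pos y → x ≡ y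
    pos-injective ex ey e = trans (sym (rot-pos ex)) (trans (cong rot e) (rot-pos ey))

    tail-rot : ∀ k → tail (rot k) ≡ v
    tail-rot k = trans (tail-iter G k b) b≡v

    -- A repetition i < j ≤ pos z would produce z earlier, at i + (pos z ∸ j).
    rot-distinct : ∀ {z} → tail z ≡ v → ∀ {i j} → i < j → j ≤ pos z → rot i ≢ rot j
    rot-distinct {z} ez {i} {j} i<j j≤z e = pos-least ez
      (ℕ.<-≤-trans (ℕ.+-monoʳ-< (pos z ∸ j) i<j) (ℕ.≤-reflexive (ℕ.m∸n+n≡m j≤z)))
      (trans (iter-+ (pos z ∸ j) i σ b) (trans (cong (iter (pos z ∸ j) σ) e) (trans (sym (iter-+ (pos z ∸ j) j σ b))
        (trans (cong rot (ℕ.m∸n+n≡m j≤z)) (rot-pos ez)))))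

    module _ (D : Curve G) where

      side-flip-σ : ∀ {e} → EdgeIn G (cycle D) e → side D (σ e) ≡ not (side D e)
      side-flip-σ {e} on = trans (cong (side D) (sym (φ-σ G e))) (trans (turn D (α e)) (flip D on))

      side-segment : ∀ m lo → (∀ {j} → lo ≤ j → j < m + lo → ¬ EdgeIn G (cycle D) (rot j)) →
        side D (rot (m + lo)) ≡ side D (rot lo)
      side-segment zero    lo off = refl
      side-segment (suc m) lo off = trans (side-σ G D (off (ℕ.m≤n+m lo m) (ℕ.n<1+n (m + lo))))
        (side-segment m lo λ lo≤j j<m → off lo≤j (ℕ.m<n⇒m<1+n j<m))

      side-range : ∀ {lo hi} → lo ≤ hi → (∀ {j} → lo ≤ j → j < hi → ¬ EdgeIn G (cycle D) (rot j)) →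
        side D (rot hi) ≡ side D (rot lo)
      side-range {lo} {hi} lo≤hi off = subst (λ h → side D (rot h) ≡ side D (rot lo)) (ℕ.m∸n+n≡m lo≤hi)
        (side-segment (hi ∸ lo) lo λ {j} lo≤j j<hi → off lo≤j (subst (j <_) (ℕ.m∸n+n≡m lo≤hi) j<hi))

      module _ {x y} (tx : tail x ≡ v) (ty : tail y ≡ v) (on-x : EdgeIn G (cycle D) x) (on-y : EdgeIn G (cycle D) y)
        (only : ∀ {e} → tail e ≡ v → EdgeIn G (cycle D) e → e ≡ x ⊎ e ≡ y) (x<y : pos x < pos y) where

        private
          off : ∀ {z j} → tail z ≡ v → j < pos z → pos x ≢ j → pos y ≢ j → pos x ≤ pos z → (pos y ≤ pos z) ⊎ (j < pos y) → ¬ EdgeIn G (cycle D) (rot j)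
          off {z} {j} tz j<z x≢j y≢j x≤z y≤z on = [ hit tx x≢j x≤z , at-y y≤z ]′ (only (tail-rot j) on)
            where
            hit : ∀ {q} → tail q ≡ v → pos q ≢ j → pos q ≤ pos z → rot j ≢ q
            hit {q} tq q≢j q≤z e with ℕ.<-cmp j (pos q)
            ... | tri< lt _ _ = pos-least tq lt e
            ... | tri≈ _ eq _ = q≢j (sym eq)
            ... | tri> _ _ gt = rot-distinct tz gt (ℕ.<⇒≤ j<z) (trans (rot-pos tq) (sym e))
            at-y : (pos y ≤ pos z) ⊎ (j < pos y) → rot j ≢ y
            at-y (inj₁ y≤z) = hit ty y≢j y≤z
            at-y (inj₂ j<y) = pos-least ty j<y

        side-before : ∀ {z} → tail z ≡ v → pos z < pos x → side D z ≡ side D b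
        side-before {z} tz z<x = trans (cong (side D) (sym (rot-pos tz))) (side-range z≤n λ {j} _ j<z →
          let j<x = ℕ.<-trans j<z z<x ; j<y = ℕ.<-trans j<x x<y in
          λ on → [ pos-least tx j<x , pos-least ty j<y ]′ (only (tail-rot j) on))

        private
          side-x : side D x ≡ side D b
          side-x = trans (cong (side D) (sym (rot-pos tx))) (side-range z≤n λ {j} _ j<x on →
            [ pos-least tx j<x , pos-least ty (ℕ.<-trans j<x x<y) ]′ (only (tail-rot j) on))

          past : ∀ {q} → tail q ≡ v → EdgeIn G (cycle D) q → side D (rot (suc (pos q))) ≡ not (side D q)
          past tq on = trans (cong (side D ∘ σ) (rot-pos tq)) (side-flip-σ on)

          -- The bound `pos z ≤ pos y` includes `y` itself: a dart of the cycle still has the colour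
          -- before the change, and `side-after` needs the colour of `y` to compute the second
          -- change.
          until-y : ∀ {z} → tail z ≡ v → pos x < pos z → pos z ≤ pos y → side D z ≡ not (side D b)
          until-y {z} tz x<z z≤y = trans (cong (side D) (sym (rot-pos tz)))
            (trans (side-range x<z λ {j} x<j j<z → off tz j<z (ℕ.<⇒≢ x<j) (ℕ.<⇒≢ (ℕ.<-≤-trans j<z z≤y) ∘ sym) (ℕ.<⇒≤ x<z) (inj₂ (ℕ.<-≤-trans j<z z≤y)))
              (trans (past tx on-x) (cong not side-x)))

        side-between : ∀ {z} → tail z ≡ v → pos x < pos z → pos z < pos y → side D z ≡ not (side D b)
        side-between tz x<z z<y = until-y tz x<z (ℕ.<⇒≤ z<y)

        side-after : ∀ {z} → tail z ≡ v → pos y < pos z → side D z ≡ side D b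
        side-after {z} tz y<z = trans (cong (side D) (sym (rot-pos tz)))
          (trans (side-range y<z λ {j} y<j j<z → off tz j<z (ℕ.<⇒≢ (ℕ.<-trans x<y y<j)) (ℕ.<⇒≢ y<j)
                   (ℕ.<⇒≤ (ℕ.<-trans x<y y<z)) (inj₁ (ℕ.<⇒≤ y<z)))
            (trans (past ty on-y) (trans (cong not (until-y ty x<y ℕ.≤-refl)) (Bool.not-involutive (side D b)))))

  -- Cycles formed by two tree paths with common ends

  module Theta {v r : Fin n} (L : Levels G v r) (D t : ℕ) (w : Fin n) (t<D : t < D) where
    open Levels L
    open Tree G L

    H : ℕ
    H = suc t

    record Spoke (x : Fin d) : Set where
      field
        at-v   : tail x ≡ v
        at-D   : depth (tail (α x)) ≡ D
        toward : anc H (tail (α x)) ≡ w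

    open Spoke

    u : Fin d → Fin n
    u x = tail (α x)

    -- Distinctness one step before `w` is enough, because ancestor paths that merge at equal depth
    -- stay merged.
    Apart : Fin d → Fin d → Set
    Apart x y = anc t (u x) ≢ anc t (u y)

    -- Used for indices up to `H`: the spoke, then `H` parent darts, the last of which ends at `w`.
    path : Fin d → ℕ → Fin d
    path x zero    = x
    path x (suc s) = parentDart (anc s (u x))

    path-head : ∀ x k → tail (α (path x k)) ≡ anc k (u x)
    path-head x zero    = refl
    path-head x (suc k) = refl

    path-tail : ∀ x k → tail (path x (suc k)) ≡ anc k (u x)
    path-tail x k = tail-parentDart (anc k (u x))

    OnPath : Fin d → Fin d → Set
    OnPath x e = ∃ λ k → k ≤ H × (path x k ≡ e ⊎ α (path x k) ≡ e)

    module _ {x} (sx : Spoke x) where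

      level : ∀ {a} → a ≤ H → anc a (u x) ≢ v × depth (anc a (u x)) ≡ D ∸ a
      level {a} a≤H = anc-level a (λ e → no-loop G x (trans (at-v sx) (sym e)))
        (trans (at-D sx) (sym (ℕ.m+[n∸m]≡n (ℕ.≤-trans a≤H t<D))))

      anc≢v : ∀ {a} → a ≤ H → anc a (u x) ≢ v
      anc≢v = proj₁ ∘ level

    same-level : ∀ {x y} → Spoke x → Spoke y → ∀ {a b} → a ≤ H → b ≤ H → anc a (u x) ≡ anc b (u y) → a ≡ b
    same-level sx sy {a} {b} a≤H b≤H e = ℕ.∸-cancelˡ-≡ (ℕ.≤-trans a≤H t<D) (ℕ.≤-trans b≤H t<D)
      (trans (sym (proj₂ (level sx a≤H))) (trans (cong depth e) (proj₂ (level sy b≤H))))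

    -- Depth forces the two indices to agree; a meeting before `H` would make the `t`-th ancestors
    -- equal as well.
    meet : ∀ {x y} → Spoke x → Spoke y → Apart x y → ∀ {a b} → a ≤ H → b ≤ H → anc a (u x) ≡ anc b (u y) → a ≡ H
    meet {x} {y} sx sy apart {a} {b} a≤H b≤H e with ℕ.m≤n⇒m<n∨m≡n a≤H
    ... | inj₂ a≡H = a≡H
    ... | inj₁ (s≤s a≤t) with same-level sx sy a≤H b≤H e
    ...   | refl = ⊥-elim (apart (trans (lift x) (trans (cong (anc (t ∸ a)) e) (sym (lift y)))))
      where
      lift : ∀ x → anc t (u x) ≡ anc (t ∸ a) (anc a (u x))
      lift x = trans (cong (λ s → anc s (u x)) (sym (ℕ.m∸n+n≡m a≤t))) (iter-+ (t ∸ a) a par (u x))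

    path-distinct : ∀ {x} → Spoke x → ∀ {a b} → a < b → b ≤ H → tail (path x a) ≢ tail (path x b)
    path-distinct {x} sx {zero}  {suc b} _ (s≤s b≤t) e =
      anc≢v sx (ℕ.m≤n⇒m≤1+n b≤t) (trans (sym (path-tail x b)) (trans (sym e) (at-v sx)))
    path-distinct {x} sx {suc a} {suc b} (s≤s a<b) (s≤s b≤t) e = ℕ.<⇒≢ a<b
      (same-level sx sx (ℕ.≤-trans (ℕ.<⇒≤ a<b) (ℕ.m≤n⇒m≤1+n b≤t)) (ℕ.m≤n⇒m≤1+n b≤t)
        (trans (sym (path-tail x a)) (trans e (path-tail x b))))

    path-antisym : ∀ {x} → Spoke x → ∀ {a b} → a ≤ H → b ≤ H → path x a ≢ α (path x b)
    path-antisym {x} sx {zero} {b} a≤H b≤H e = anc≢v sx b≤H (trans (sym (path-head x b)) (trans (cong tail (sym e)) (at-v sx)))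
    path-antisym {x} sx {suc a} {zero} a≤H b≤H e =
      anc≢v sx a≤H (trans (cong (tail ∘ α) e) (trans (cong tail (α-invol x)) (at-v sx)))
    path-antisym {x} sx {suc a} {suc b} a≤H b≤H e = ℕ.<-asym (ℕ.≤-reflexive b<a) (ℕ.≤-reflexive a<b)
      where
      b<a : suc b ≡ a
      b<a = same-level sx sx b≤H (ℕ.<⇒≤ a≤H) (trans (cong tail (sym e)) (path-tail x a))
      a<b : suc a ≡ b
      a<b = same-level sx sx a≤H (ℕ.<⇒≤ b≤H)
        (trans (cong (tail ∘ α) e) (trans (cong tail (α-invol (path x (suc b)))) (path-tail x b)))

    path-disjoint : ∀ {x y} → Spoke x → Spoke y → Apart x y → ∀ {a b} → a ≤ H → b ≤ H → path x a ≢ path y b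
    path-disjoint {x} {y} sx sy apart {a} {b} a≤H b≤H e
      with meet sx sy apart a≤H b≤H heads | meet sy sx (apart ∘ sym) b≤H a≤H (sym heads)
      where
      heads : anc a (u x) ≡ anc b (u y)
      heads = trans (sym (path-head x a)) (trans (cong (tail ∘ α) e) (path-head y b))
    ... | refl | refl = apart (trans (sym (path-tail x t)) (trans (cong tail e) (path-tail y t)))

    path-meets : ∀ {x y} → Spoke x → Spoke y → Apart x y → ∀ {a b} → a ≤ H → b ≤ H → tail (path x a) ≢ anc b (u y)
    path-meets sx sy apart {zero}  a≤H b≤H e = anc≢v sy b≤H (trans (sym e) (at-v sx))
    path-meets {x} sx sy apart {suc a} a≤H b≤H e =
      ℕ.<-irrefl (meet sx sy apart (ℕ.<⇒≤ a≤H) b≤H (trans (sym (path-tail x a)) e)) a≤H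

    path-only : ∀ {x e} → Spoke x → tail e ≡ v → OnPath x e → e ≡ x
    path-only sx te (zero  , _ , inj₁ p) = sym p
    path-only {x} sx te (suc k , k≤H , inj₁ p) = ⊥-elim (anc≢v sx (ℕ.<⇒≤ k≤H) (trans (sym (path-tail x k)) (trans (cong tail p) te)))
    path-only {x} sx te (k , k≤H , inj₂ p) = ⊥-elim (anc≢v sx k≤H (trans (sym (path-head x k)) (trans (cong tail p) te)))

    module Pair {x y} (sx : Spoke x) (sy : Spoke y) (apart : Apart x y) where

      -- Two paths of `suc H` darts give `2H + 2` darts, one more than `len`. On the way back, index
      -- `k` uses dart `len ∸ k`, which runs from `H` down to 0.
      len : ℕ
      len = H + suc H

      walk : ℕ → Fin d
      walk k with k ℕ.≤? H
      ... | yes _ = path x k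
      ... | no _  = α (path y (len ∸ k))

      -- Out along the path of x, then back along the path of y.
      data Place : ℕ → Set where
        out  : ∀ {k} → k ≤ H → walk k ≡ path x k → Place k
        back : ∀ {k} → suc H ≤ k → walk k ≡ α (path y (len ∸ k)) → Place k

      place : ∀ k → Place k
      place k with k ℕ.≤? H in eq
      ... | yes k≤H = out k≤H (walk-yes eq)
        where
        walk-yes : ∀ {k p} → (k ℕ.≤? H) ≡ yes p → walk k ≡ path x k
        walk-yes e rewrite e = refl
      ... | no k≰H = back (ℕ.≰⇒> k≰H) (walk-no eq)
        where
        walk-no : ∀ {k p} → (k ℕ.≤? H) ≡ no p → walk k ≡ α (path y (len ∸ k))
        walk-no e rewrite e = refl

      rest≤H : ∀ {k} → suc H ≤ k → len ∸ k ≤ H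
      rest≤H {k} H<k = ℕ.≤-trans (ℕ.∸-monoʳ-≤ len H<k) (ℕ.≤-reflexive (ℕ.m+n∸n≡m H (suc H)))

      tail-back : ∀ k → walk k ≡ α (path y (len ∸ k)) → tail (walk k) ≡ anc (len ∸ k) (u y)
      tail-back k e = trans (cong tail e) (path-head y (len ∸ k))

      step : ∀ k → k < len → tail (α (walk k)) ≡ tail (walk (suc k))
      step k k<len with place k | place (suc k)
      ... | out _ e   | out _ e'  = trans (cong (tail ∘ α) e) (trans (path-head x k)
              (trans (sym (path-tail x k)) (sym (cong tail e'))))
      -- The turning point: `k` equals `H`, and both paths have `w` as their `H`-th ancestor.
      ... | out k≤H e | back H≤k e' with ℕ.≤-antisym k≤H (ℕ.≤-pred H≤k)
      ...   | refl = trans (cong (tail ∘ α) e) (trans (path-head x H) (trans (toward sx)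
              (trans (sym (toward sy)) (trans (cong (λ s → anc s (u y)) (sym (ℕ.m+n∸n≡m H (suc H)))) (sym (tail-back (suc k) e'))))))
      step k k<len | back H<k _ | out k<H _ = ⊥-elim (ℕ.<-asym H<k k<H)
      step k k<len | back H<k e | back _ e' = trans (cong (tail ∘ α) e) (trans (cong tail (α-invol _))
              (trans (cong (tail ∘ path y) (sym suc-∸)) (trans (path-tail y (len ∸ suc k)) (sym (tail-back (suc k) e')))))
        where
        suc-∸ : suc (len ∸ suc k) ≡ len ∸ k
        suc-∸ = sym (ℕ.+-∸-assoc 1 k<len)

      closes : tail (α (walk len)) ≡ tail (walk 0)
      closes with place len | place 0
      ... | out len≤H _ | _ = ⊥-elim (ℕ.<-irrefl refl (ℕ.≤-trans (ℕ.m≤n+m (suc H) H) len≤H))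
      ... | back _ e | out _ e' = trans (cong (tail ∘ α) e) (trans (cong tail (α-invol _))
              (trans (cong (tail ∘ path y) (ℕ.n∸n≡0 len)) (trans (at-v sy) (trans (sym (at-v sx)) (sym (cong tail e'))))))

      distinct : ∀ {a b} → a < b → b ≤ len → tail (walk a) ≢ tail (walk b)
      distinct {a} {b} a<b b≤len eq with place a | place b
      ... | out _ e   | out b≤H e' = path-distinct sx a<b b≤H (trans (sym (cong tail e)) (trans eq (cong tail e')))
      ... | out a≤H e | back H<b e' = path-meets sx sy apart a≤H (rest≤H H<b) (trans (sym (cong tail e)) (trans eq (tail-back b e')))
      ... | back H<a _ | out b≤H _ = ℕ.<-irrefl refl (ℕ.≤-trans H<a (ℕ.≤-trans (ℕ.<⇒≤ a<b) b≤H))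
      ... | back H<a e | back H<b e' = ℕ.<⇒≢ a<b (ℕ.∸-cancelˡ-≡ (ℕ.≤-trans (ℕ.<⇒≤ a<b) b≤len) b≤len
              (same-level sy sy (rest≤H H<a) (rest≤H H<b) (trans (sym (tail-back a e)) (trans eq (tail-back b e')))))

      antisym : ∀ {a b} → a ≤ len → b ≤ len → walk a ≢ α (walk b)
      antisym {a} {b} _ _ eq with place a | place b
      ... | out a≤H e | out b≤H e' = path-antisym sx a≤H b≤H (trans (sym e) (trans eq (cong α e')))
      ... | out a≤H e | back H<b e' = path-disjoint sx sy apart a≤H (rest≤H H<b)
              (trans (sym e) (trans eq (trans (cong α e') (α-invol _))))
      ... | back H<a e | out b≤H e' = path-disjoint sx sy apart b≤H (rest≤H H<a)
              (α-injective (trans (cong α (sym e')) (trans (sym eq) e)))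
      ... | back H<a e | back H<b e' = path-antisym sy (rest≤H H<a) (rest≤H H<b)
              (α-injective (trans (sym e) (trans eq (cong α e'))))

      theta : Cycle G
      theta = cycleOf G len walk step closes distinct antisym

      theta-edge : ∀ {e} → EdgeIn G theta e → OnPath x e ⊎ OnPath y e
      theta-edge (k , on) with place (toℕ k) | on
      ... | out k≤H e | inj₁ p = inj₁ (toℕ k , k≤H , inj₁ (trans (sym e) p))
      ... | out k≤H e | inj₂ p = inj₁ (toℕ k , k≤H , inj₂ (trans (cong α (sym e)) p))
      ... | back H<k e | inj₁ p = inj₂ (len ∸ toℕ k , rest≤H H<k , inj₂ (trans (sym e) p))
      ... | back H<k e | inj₂ p = inj₂ (len ∸ toℕ k , rest≤H H<k , inj₁ (trans (sym (α-invol _)) (trans (cong α (sym e)) p)))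

      theta-vertex : ∀ {q} → VertexIn G theta q → q ≡ v ⊎ ((∃ λ a → a ≤ H × anc a (u x) ≡ q) ⊎ (∃ λ a → a ≤ H × anc a (u y) ≡ q))
      theta-vertex (k , p) with place (toℕ k)
      ... | back H<k e = inj₂ (inj₂ (len ∸ toℕ k , rest≤H H<k , trans (sym (tail-back (toℕ k) e)) p))
      ... | out k≤H e = first (toℕ k) k≤H (trans (sym (cong tail e)) p)
        where
        first : ∀ k → k ≤ H → tail (path x k) ≡ _ → _
        first zero    _   p = inj₁ (trans (sym p) (at-v sx))
        first (suc k) k≤H p = inj₂ (inj₁ (k , ℕ.<⇒≤ k≤H , trans (sym (path-tail x k)) p))

      theta-x : EdgeIn G theta x
      theta-x = zero , inj₁ refl

      theta-y : EdgeIn G theta y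
      theta-y = Fin.fromℕ len , inj₂ (trans (cong (α ∘ walk) (Fin.toℕ-fromℕ len)) last)
        where
        last : α (walk len) ≡ y
        last with place len
        ... | out len≤H _ = ⊥-elim (ℕ.<-irrefl refl (ℕ.≤-trans (ℕ.m≤n+m (suc H) H) len≤H))
        ... | back _ e = trans (cong α e) (trans (α-invol _) (cong (path y) (ℕ.n∸n≡0 len)))

      theta-v : VertexIn G theta v
      theta-v = zero , at-v sx

      theta-w : VertexIn G theta w
      theta-w = Fin.fromℕ< turn<len , trans (cong (tail ∘ walk) (Fin.toℕ-fromℕ< turn<len)) middle
        where
        turn<len : suc H < suc len
        turn<len = s≤s (ℕ.m≤n+m (suc H) H)
        middle : tail (walk (suc H)) ≡ w
        middle with place (suc H)
        ... | out H<H _ = ⊥-elim (ℕ.<-irrefl refl H<H)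
        ... | back _ e = trans (tail-back (suc H) e) (trans (cong (λ s → anc s (u y)) (ℕ.m+n∸n≡m H (suc H))) (toward sy))

      theta-only : ∀ {e} → tail e ≡ v → EdgeIn G theta e → e ≡ x ⊎ e ≡ y
      theta-only te on = Sum.map (path-only sx te) (path-only sy te) (theta-edge on)

      curve : Curve G
      curve = record { cycle = theta ; sides = jordan G theta }

    module Family (b : Fin d) (b≡v : tail b ≡ v) where
      open Rotation b b≡v

      record Loop : Set where
        field
          {x y}   : Fin d
          spoke-x : Spoke x
          spoke-y : Spoke y
          apart   : Apart x y
          x<y     : pos x < pos y

        open Pair spoke-x spoke-y apart public

        -- The colours are chosen so that `b`, where the rotation is cut open, is always outside;
        -- all loops then share one reference.
        loop : Curve G
        loop with side curve b
        ... | false = curve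
        ... | true  = complement G curve

        loop-cycle : cycle loop ≡ theta
        loop-cycle with side curve b
        ... | false = refl
        ... | true  = refl

        loop-b : side loop b ≡ false
        loop-b with side curve b in eq
        ... | false = eq
        ... | true  = cong not eq

        loop-edge : ∀ {e} → EdgeIn G (cycle loop) e → OnPath x e ⊎ OnPath y e
        loop-edge {e} on = theta-edge (subst (λ C → EdgeIn G C e) loop-cycle on)

        loop-vertex : ∀ {q} → VertexIn G (cycle loop) q → q ≡ v ⊎ ((∃ λ a → a ≤ H × anc a (u x) ≡ q) ⊎ (∃ λ a → a ≤ H × anc a (u y) ≡ q))
        loop-vertex {q} on = theta-vertex (subst (λ C → VertexIn G C q) loop-cycle on)

        on-x : EdgeIn G (cycle loop) x
        on-x = subst (λ C → EdgeIn G C x) (sym loop-cycle) theta-x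

        on-y : EdgeIn G (cycle loop) y
        on-y = subst (λ C → EdgeIn G C y) (sym loop-cycle) theta-y

        only : ∀ {e} → tail e ≡ v → EdgeIn G (cycle loop) e → e ≡ x ⊎ e ≡ y
        only {e} te on = theta-only te (subst (λ C → EdgeIn G C e) loop-cycle on)

        vertex-v : VertexIn G (cycle loop) v
        vertex-v = subst (λ C → VertexIn G C v) (sym loop-cycle) theta-v

        vertex-w : VertexIn G (cycle loop) w
        vertex-w = subst (λ C → VertexIn G C w) (sym loop-cycle) theta-w

        -- The path of a third spoke meets the loop only at its ends `v` and `w`, so its colour is
        -- decided by its first dart at `v`.
        along : ∀ {z} → Spoke z → Apart z x → Apart z y → ∀ {e} → OnPath z e → side loop e ≡ side loop z
        along {z} sz zx zy (k , k≤H , p) = on-path p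
          where
          off : ∀ {a} → a ≤ t → ¬ VertexIn G (cycle loop) (anc a (u z))
          off {a} a≤t on with loop-vertex on
          ... | inj₁ e = anc≢v sz (ℕ.m≤n⇒m≤1+n a≤t) e
          ... | inj₂ (inj₁ (a' , a'≤H , e)) = ℕ.<-irrefl (meet sz spoke-x zx (ℕ.m≤n⇒m≤1+n a≤t) a'≤H (sym e)) (s≤s a≤t)
          ... | inj₂ (inj₂ (a' , a'≤H , e)) = ℕ.<-irrefl (meet sz spoke-y zy (ℕ.m≤n⇒m≤1+n a≤t) a'≤H (sym e)) (s≤s a≤t)
          z-off : ¬ EdgeIn G (cycle loop) z
          z-off on = [ (λ e → zx (cong (anc t ∘ u) e)) , (λ e → zy (cong (anc t ∘ u) e)) ]′ (only (at-v sz) on)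
          go : ∀ k → k ≤ H → side loop (path z k) ≡ side loop z × side loop (α (path z k)) ≡ side loop z
          go zero    _   = refl , stay loop z-off
          go (suc k) (s≤s k≤t) = here-side , trans (stay-tail G loop (off k≤t ∘ subst (VertexIn G (cycle loop)) (path-tail z k))) here-side
            where
            here-side : side loop (path z (suc k)) ≡ side loop z
            here-side = trans (side-rotate G loop (off k≤t) (path-tail z k) (path-head z k)) (proj₂ (go k (ℕ.m≤n⇒m≤1+n k≤t)))
          on-path : ∀ {e} → path z k ≡ e ⊎ α (path z k) ≡ e → side loop e ≡ side loop z
          on-path (inj₁ refl) = proj₁ (go k k≤H)
          on-path (inj₂ refl) = proj₂ (go k k≤H)

      open Loop

      poles : Subset n
      poles = ⁅ v ⁆ ∪ ⁅ w ⁆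

      -- Nested intervals in the rotation at `v`, with paths of the two loops disjoint apart from
      -- their ends.
      record Encloses (O I : Loop) : Set where
        field
          x<x : pos (x O) < pos (x I)
          y<y : pos (y I) < pos (y O)
          xx : Apart (x O) (x I)
          xy : Apart (x O) (y I)
          yx : Apart (y O) (x I)
          yy : Apart (y O) (y I)

      -- By `along` only the colours at `v` matter: the spokes of `I` lie between those of `O`, and
      -- the spokes of `O` lie before or after those of `I`.
      encloses⇒precedes : ∀ {O I} → Encloses O I → Precedes G poles (loop O) (loop I)
      encloses⇒precedes {O} {I} h = record { inner = inner ; outer = outer ; common = common }
        where
        open Encloses h
        inner : ∀ {e} → EdgeIn G (cycle (loop I)) e → side (loop O) e ≡ true
        inner on with loop-edge I on
        ... | inj₁ p = trans (along O (spoke-x I) (xx ∘ sym) (yx ∘ sym) p)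
                (trans (side-between (loop O) (at-v (spoke-x O)) (at-v (spoke-y O)) (on-x O) (on-y O) (only O) (x<y O)
                          (at-v (spoke-x I)) x<x (ℕ.<-trans (x<y I) y<y)) (cong not (loop-b O)))
        ... | inj₂ p = trans (along O (spoke-y I) (xy ∘ sym) (yy ∘ sym) p)
                (trans (side-between (loop O) (at-v (spoke-x O)) (at-v (spoke-y O)) (on-x O) (on-y O) (only O) (x<y O)
                          (at-v (spoke-y I)) (ℕ.<-trans x<x (x<y I)) y<y) (cong not (loop-b O)))
        outer : ∀ {e} → EdgeIn G (cycle (loop O)) e → side (loop I) e ≡ false
        outer on with loop-edge O on
        ... | inj₁ p = trans (along I (spoke-x O) xx xy p)
                (trans (side-before (loop I) (at-v (spoke-x I)) (at-v (spoke-y I)) (on-x I) (on-y I) (only I) (x<y I)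
                          (at-v (spoke-x O)) x<x) (loop-b I))
        ... | inj₂ p = trans (along I (spoke-y O) yx yy p)
                (trans (side-after (loop I) (at-v (spoke-x I)) (at-v (spoke-y I)) (on-x I) (on-y I) (only I) (x<y I)
                          (at-v (spoke-y O)) y<y) (loop-b I))
        at-w : ∀ {z z' a a' q} → Spoke z → Spoke z' → Apart z z' → a ≤ H → a' ≤ H → anc a (u z) ≡ q → anc a' (u z') ≡ q → q ∈ₛ poles
        at-w sz sz' zz' a≤H a'≤H e e' with meet sz sz' zz' a≤H a'≤H (trans e (sym e'))
        ... | refl = Subset.x∈p∪q⁺ (inj₂ (subst (_∈ₛ ⁅ w ⁆) (trans (sym (toward sz)) e) (Subset.x∈⁅x⁆ w)))
        at-v∈ : ∀ {q} → q ≡ v → q ∈ₛ poles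
        at-v∈ refl = Subset.x∈p∪q⁺ (inj₁ (Subset.x∈⁅x⁆ v))
        both : ∀ {q} → VertexIn G (cycle (loop O)) q → VertexIn G (cycle (loop I)) q → q ∈ₛ poles
        both on on' with loop-vertex O on | loop-vertex I on'
        ... | inj₁ e | _ = at-v∈ e
        ... | inj₂ _ | inj₁ e = at-v∈ e
        ... | inj₂ (inj₁ (a , le , e)) | inj₂ (inj₁ (a' , le' , e')) = at-w (spoke-x O) (spoke-x I) xx le le' e e'
        ... | inj₂ (inj₁ (a , le , e)) | inj₂ (inj₂ (a' , le' , e')) = at-w (spoke-x O) (spoke-y I) xy le le' e e'
        ... | inj₂ (inj₂ (a , le , e)) | inj₂ (inj₁ (a' , le' , e')) = at-w (spoke-y O) (spoke-x I) yx le le' e e'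
        ... | inj₂ (inj₂ (a , le , e)) | inj₂ (inj₂ (a' , le' , e')) = at-w (spoke-y O) (spoke-y I) yy le le' e e'
        common : ∀ q → (VertexIn G (cycle (loop O)) q × VertexIn G (cycle (loop I)) q) ⇔ (q ∈ₛ poles)
        common q = mk⇔ (λ (on , on') → both on on') λ q∈ → [ (λ q∈v → in-both (Subset.x∈⁅y⁆⇒x≡y v q∈v) (vertex-v O) (vertex-v I))
                                                            , (λ q∈w → in-both (Subset.x∈⁅y⁆⇒x≡y w q∈w) (vertex-w O) (vertex-w I)) ]′
                                                            (Subset.x∈p∪q⁻ ⁅ v ⁆ ⁅ w ⁆ q∈)
          where
          in-both : ∀ {q p} → q ≡ p → VertexIn G (cycle (loop O)) p → VertexIn G (cycle (loop I)) p →
            VertexIn G (cycle (loop O)) q × VertexIn G (cycle (loop I)) q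
          in-both refl on on' = on , on'

      -- Pairing position `i` with position `i` from the end turns `4k` spokes into `2k` rings, of
      -- which the outer face keeps half. Taking `k` positive provides a spoke to witness `v ≢ w`,
      -- so that the poles are two vertices.
      spokes⇒nest : ∀ o l xs → let k = suc l in All Spoke xs → AllPairs (λ x y → pos x < pos y) xs → AllPairs Apart xs →
        (k + k) + (k + k) ≤ length xs → ∃ λ s → s ≤ 2 × HasNest G o s k
      spokes⇒nest o l xs spokes sorted aparts long = ∣ poles ∣ , ℕ.≤-reflexive (∣⁅x⁆∪⁅y⁆∣≡2 v≢w) ,
        family⇒nest G o poles k (tabulate (loop ∘ ring))
          (AllPairs.tabulate⁺-< λ {i} {j} i<j → encloses⇒precedes {ring i} {ring j} (enclose i<j))
          (ℕ.≤-reflexive (sym (length-tabulate (loop ∘ ring))))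
        where
        k = suc l
        m = k + k
        first last : Fin m → Fin (length xs)
        first i = inject≤ (i ↑ˡ m) long
        last i  = inject≤ (opposite (i ↑ˡ m)) long
        toℕ-first : ∀ i → toℕ (first i) ≡ toℕ i
        toℕ-first i = trans (Fin.toℕ-inject≤ (i ↑ˡ m) long) (Fin.toℕ-↑ˡ i m)
        toℕ-last : ∀ i → toℕ (last i) ≡ m + m ∸ suc (toℕ i)
        toℕ-last i = trans (Fin.toℕ-inject≤ (opposite (i ↑ˡ m)) long)
          (trans (Fin.opposite-prop (i ↑ˡ m)) (cong (λ a → m + m ∸ suc a) (Fin.toℕ-↑ˡ i m)))
        first<last : ∀ i j → first i Fin.< last j
        first<last i j = subst₂ _<_ (sym (toℕ-first i)) (sym (toℕ-last j))
          (ℕ.<-≤-trans (Fin.toℕ<n i) (ℕ.≤-trans (ℕ.≤-reflexive (sym (ℕ.m+n∸n≡m m m))) (ℕ.∸-monoʳ-≤ (m + m) (Fin.toℕ<n j))))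
        first-mono : ∀ {i j} → i Fin.< j → first i Fin.< first j
        first-mono {i} {j} i<j = subst₂ _<_ (sym (toℕ-first i)) (sym (toℕ-first j)) i<j
        last-mono : ∀ {i j} → i Fin.< j → last j Fin.< last i
        last-mono {i} {j} i<j = subst₂ _<_ (sym (toℕ-last j)) (sym (toℕ-last i))
          (ℕ.∸-monoʳ-< (s≤s i<j) (ℕ.≤-trans (Fin.toℕ<n j) (ℕ.m≤m+n m m)))
        spoke : ∀ i → Spoke (lookup xs i)
        spoke i = All.lookup spokes (∈-lookup i)
        v≢w : v ≢ w
        v≢w e = anc≢v (spoke (first zero)) ℕ.≤-refl (trans (toward (spoke (first zero))) (sym e))
        ring : Fin m → Loop
        ring i = record
          { spoke-x = spoke (first i) ; spoke-y = spoke (last i)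
          ; apart = lookup-pairs aparts (first<last i i) ; x<y = lookup-pairs sorted (first<last i i) }
        enclose : ∀ {i j} → i Fin.< j → Encloses (ring i) (ring j)
        enclose {i} {j} i<j = record
          { x<x = lookup-pairs sorted (first-mono i<j)
          ; y<y = lookup-pairs sorted (last-mono i<j)
          ; xx = lookup-pairs aparts (first-mono i<j)
          ; xy = lookup-pairs aparts (first<last i j)
          ; yx = lookup-pairs aparts (first<last j i) ∘ sym
          ; yy = lookup-pairs aparts (last-mono i<j) ∘ sym
          }

-- Combining deep layers with bounded radius

module _ {n d : ℕ} (G : PlaneTriangulation n d) (o : Fin d) (l c : ℕ)
  (4k≤c : (suc l + suc l) + (suc l + suc l) ≤ c) where
  open PlaneTriangulation G

  private
    Goal : Set
    Goal = ∃ λ s → s ≤ 2 × HasNest G o s (suc l)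

  shallow-or-nest : ∀ {v r} (L : Levels G v r) → Goal ⊎ (∀ {u} → u ≢ v → Levels.depth L u ≤ c)
  shallow-or-nest {v} L with Fin.any? (λ u → ¬? (u Fin.≟ v) ×-dec (c ℕ.<? Levels.depth L u))
  ... | yes (u , u≢v , deep) = inj₁ (deep⇒nest G L o (suc l) u u≢v (ℕ.≤-<-trans 4k≤c deep))
  ... | no none = inj₂ λ {u} u≢v → ℕ.≮⇒≥ λ deep → none (u , u≢v , deep)

  -- The number `c` has two roles: it bounds the depth in the shallow case, and as `c` is at least
  -- `4k` it is also the number of spokes asked of `branch`.
  many-neighbours⇒nest : ∀ v xs M → All (λ x → tail x ≡ v) xs → AllPairs (λ x y → tail (α x) ≢ tail (α y)) xs →
    required c c ≤ M → M ≤ length xs → Goal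
  many-neighbours⇒nest v xs M tails heads enough long = go (shallow-or-nest L)
    where
    b = proj₁ (tail-surj v)
    b≡v = proj₂ (tail-surj v)
    L : Levels G v (tail (α b))
    L = levels G λ e → no-loop G b (trans b≡v (sym e))
    open Rotation G b b≡v
    open Tree G L
    differ : ∀ {xs} → All (λ x → tail x ≡ v) xs → AllPairs (λ x y → tail (α x) ≢ tail (α y)) xs → AllPairs (λ x y → pos x ≢ pos y) xs
    differ = allPairs-with λ tx ty ne e → ne (cong (tail ∘ α) (pos-injective tx ty e))
    -- Sorting precedes branching because the sublist returned by `branch` inherits the order of the
    -- rotation.
    sorting = strictly-sorted pos (differ tails heads)
    ys = proj₁ sorting
    ys↭xs : ys ↭ xs
    ys↭xs = proj₁ (proj₂ sorting)
    go : Goal ⊎ (∀ {u} → u ≢ v → Levels.depth L u ≤ c) → Goal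
    go (inj₁ goal) = goal
    go (inj₂ shallow) with branch (tail ∘ α) c c ys off-v (All.map shallow off-v)
          (AllPairs-resp-↭ (λ ne → ne ∘ sym) (↭-sym ys↭xs) heads)
          (ℕ.≤-trans enough (ℕ.≤-trans long (ℕ.≤-reflexive (sym (↭-length ys↭xs)))))
      where
      off-v : All (λ x → tail (α x) ≢ v) ys
      off-v = All.map (λ {x} tx e → no-loop G x (trans tx (sym e))) (All-resp-↭ (↭-sym ys↭xs) tails)
    ... | D , t , w , zs , t<D , zs⊆ys , many , levelled , toward , apart =
      Theta.Family.spokes⇒nest G L D t w t<D b b≡v o l zs
        (All.zipWith (λ (tx , at-D , toward) → record { at-v = tx ; at-D = at-D ; toward = toward })
          (All-resp-⊆ zs⊆ys (All-resp-↭ (↭-sym ys↭xs) tails) , All.zip (levelled , toward)))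
        (AllPairs-resp-⊆ zs⊆ys (proj₂ (proj₂ sorting))) apart (ℕ.≤-trans 4k≤c many)

-- The first tree avoids `tail o` and spans all other vertices, which explains the successor in the
-- bound on `n`. Its branching vertex `w` has `M` distinct neighbours and becomes the deleted vertex
-- of the second tree.
large⇒nest : ∀ {n d} (G : PlaneTriangulation n d) (o : Fin d) l c M → (suc l + suc l) + (suc l + suc l) ≤ c →
  required c c ≤ M → suc (required M c) ≤ n → ∃ λ s → s ≤ 2 × HasNest G o s (suc l)
large⇒nest {suc n} G o l c M 4k≤c enough (s≤s large) = go (shallow-or-nest G o l c 4k≤c L)
  where
  open PlaneTriangulation G
  L : Levels G (tail o) (tail (α o))
  L = levels G λ e → no-loop G o (sym e)
  open Tree G L
  h : Fin n → Fin (suc n)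
  h = punchIn (tail o)
  go : _ → ∃ λ s → s ≤ 2 × HasNest G o s (suc l)
  go (inj₁ goal) = goal
  go (inj₂ shallow) with branch h M c (allFin n)
        (All.tabulate⁺ λ i → Fin.punchInᵢ≢i (tail o) i)
        (All.tabulate⁺ λ i → shallow (Fin.punchInᵢ≢i (tail o) i))
        (AllPairs.tabulate⁺ λ i≢j e → i≢j (Fin.punchIn-injective (tail o) _ _ e))
        (ℕ.≤-trans large (ℕ.≤-reflexive (sym (length-tabulate {n = n} (λ i → i)))))
  ... | D , t , w , ys , t<D , _ , many , _ , toward , distinct =
    many-neighbours⇒nest G o l c 4k≤c w (map up ys) M (All.map⁺ toward)
      (AllPairs.map⁺ (AllPairs.map (λ ne e → ne (trans (sym (head-up _)) (trans e (head-up _)))) distinct))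
      enough (ℕ.≤-trans many (ℕ.≤-reflexive (sym (length-map up ys))))
    where
    up : Fin n → Fin _
    -- Parent darts point towards `w`; reversed, they start at `w` and end at the distinct children.
    up i = α (parentDart (anc t (h i)))
    head-up : ∀ i → tail (α (up i)) ≡ anc t (h i)
    head-up i = trans (cong tail (α-invol _)) (tail-parentDart _)

theorem1p2 : (k : ℕ) → ∃ λ N → ∀ {n d} (G : PlaneTriangulation n d) (o : Fin d) → N ≤ n →
    ∃ λ s → s ≤ 2 × ∃ λ t → k ≤ t × Σ (Nest G o t) (λ C → IsSNest G C s)
theorem1p2 k = suc (required M c) , λ G o large →
    let s , s≤2 , t , k<t , nest = large⇒nest G o k c M ℕ.≤-refl ℕ.≤-refl large
    in s , s≤2 , t , ℕ.<⇒≤ k<t , nest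
  where
  -- The nest is built with size `suc k`, so that the case of size zero never arises.
  c = (suc k + suc k) + (suc k + suc k)
  M = required c c
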